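{- Consider an Erd\H{o}s--R\'enyi random graph $G_{n,p}$ with $p\ge 7\left(\frac{\gamma\ln n}{n}\right)^{1/7}$ for some $\gamma>3$, labelled uniformly at random from $\{1,2,\ldots,\alpha\}$, where $\alpha\ge 4$. Then any instance $I$ of $G_{n,p}$ needs only $\Theta(n+np^5)$ time-edges to be temporally connected, with probability at least $1-2e^{ -\gamma'\ln n}$, for some $\gamma'\ge 1$; that is, with at least this probability all but $\Theta(n+np^5)$ of the labels of the labelled instance can be removed so that the remaining temporal graph is temporally connected.
   Context: $G_{n,p}$: each of the $\binom n2$ possible edges on $n$ vertices is present independently with probability $p$. "Labelled uniformly at random" means that each existing edge receives exactly one label chosen uniformly at random from $\{1,2,\ldots,\alpha\}$, independently of the labels of other edges and of the choice of edges of $G_{n,p}$. A $(u,v)$-journey is a path from $u$ to $v$ whose successive edges carry strictly increasing labels. A labelled graph is temporally connected (satisfies TC) if for every ordered pair of distinct vertices $u,v$ there is a $(u,v)$-journey. A time-edge here means an edge together with its label. -}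

module Defs where

open import Data.Bool.Base using (Bool; true; false; T; if_then_else_)
open import Data.Fin.Base using (Fin)
open import Data.Fin.Properties using (_<?_)
open import Data.Integer.Base using (+_)
open import Data.List.Base
  using (List; []; _∷_; map; concatMap; filter; filterᵇ; foldr; length;
         upTo; allFin; cartesianProduct)
open import Data.List.Membership.Propositional using (_∈_)
open import Data.List.Relation.Binary.Sublist.Propositional using (_⊆_)
open import Data.List.Relation.Unary.Linked using (Linked)
open import Data.List.Relation.Unary.Unique.Propositional using (Unique)
open import Data.Nat.Base as ℕ using (ℕ; zero; suc)
import Data.Nat.Properties as ℕ
open import Data.Product using (Σ-syntax; ∃; _×_; _,_; proj₁; proj₂)
open import Data.Rational.Base as ℚ using (ℚ; 0ℚ; 1ℚ; ½; ∣_∣)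
import Data.Rational.Properties as ℚ
open import Data.Rational.Solver using (module +-*-Solver)
open import Data.Sum.Base using (_⊎_)
open import Relation.Binary.PropositionalEquality
  using (_≡_; _≢_; refl; sym; trans; cong; cong₂; subst)

open +-*-Solver using (solve; _:+_; _:*_; :-_; _:=_)

------------------------------------------------------------------------
-- Real numbers as Cauchy sequences of rationals, with equality _≈_

Cauchy : (ℕ → ℚ) → Set
Cauchy s = ∀ ε → 0ℚ ℚ.< ε →
  ∃ λ N → ∀ i j → N ℕ.≤ i → N ℕ.≤ j → ∣ s i ℚ.- s j ∣ ℚ.≤ ε

record ℝ : Set where
  constructor mkℝ
  field
    seq    : ℕ → ℚ
    cauchy : Cauchy seq

open ℝ public

private
  ∣p-p∣≡0 : ∀ p → ∣ p ℚ.- p ∣ ≡ 0ℚ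
  ∣p-p∣≡0 p = cong ∣_∣ (ℚ.+-inverseʳ p)

  0<½ε : ∀ ε → 0ℚ ℚ.< ε → 0ℚ ℚ.< ½ ℚ.* ε
  0<½ε ε 0<ε =
    ℚ.positive⁻¹ (½ ℚ.* ε) {{ℚ.pos*pos⇒pos ½ ε {{ℚ.positive 0<ε}}}}

  ½ε+½ε≡ε : ∀ ε → ½ ℚ.* ε ℚ.+ ½ ℚ.* ε ≡ ε
  ½ε+½ε≡ε ε =
    trans (sym (ℚ.*-distribʳ-+ ε ½ ½)) (ℚ.*-identityˡ ε)

  +-cauchy : ∀ x y → Cauchy (λ i → seq x i ℚ.+ seq y i)
  +-cauchy x y ε 0<ε =
    let (M , x-close) = cauchy x (½ ℚ.* ε) (0<½ε ε 0<ε)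
        (N , y-close) = cauchy y (½ ℚ.* ε) (0<½ε ε 0<ε)
    in M ℕ.⊔ N , λ i j i≥ j≥ → begin
      ∣ (seq x i ℚ.+ seq y i) ℚ.- (seq x j ℚ.+ seq y j) ∣
        ≡⟨ cong ∣_∣ (rearrange (seq x i) (seq y i) (seq x j) (seq y j)) ⟩
      ∣ (seq x i ℚ.- seq x j) ℚ.+ (seq y i ℚ.- seq y j) ∣
        ≤⟨ ℚ.∣p+q∣≤∣p∣+∣q∣ (seq x i ℚ.- seq x j) (seq y i ℚ.- seq y j) ⟩
      ∣ seq x i ℚ.- seq x j ∣ ℚ.+ ∣ seq y i ℚ.- seq y j ∣
        ≤⟨ ℚ.+-mono-≤
             (x-close i j (ℕ.m⊔n≤o⇒m≤o M N i≥) (ℕ.m⊔n≤o⇒m≤o M N j≥))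
             (y-close i j (ℕ.m⊔n≤o⇒n≤o M N i≥) (ℕ.m⊔n≤o⇒n≤o M N j≥)) ⟩
      ½ ℚ.* ε ℚ.+ ½ ℚ.* ε
        ≡⟨ ½ε+½ε≡ε ε ⟩
      ε ∎
    where
    open ℚ.≤-Reasoning
    rearrange : ∀ a b c d →
      (a ℚ.+ b) ℚ.- (c ℚ.+ d) ≡ (a ℚ.- c) ℚ.+ (b ℚ.- d)
    rearrange = solve 4 (λ a b c d →
      (a :+ b) :+ (:- (c :+ d)) := (a :+ (:- c)) :+ (b :+ (:- d))) refl

  neg-cauchy : ∀ x → Cauchy (λ i → ℚ.- seq x i)
  neg-cauchy x ε 0<ε =
    let (N , close) = cauchy x ε 0<ε
    in N , λ i j i≥ j≥ →
      subst (ℚ._≤ ε)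
        (trans (sym (ℚ.∣-p∣≡∣p∣ (seq x i ℚ.- seq x j)))
               (cong ∣_∣ (ℚ.neg-distrib-+ (seq x i) (ℚ.- seq x j))))
        (close i j i≥ j≥)

  eventually-bounded : ∀ x → Σ[ B ∈ ℚ ] (0ℚ ℚ.< B) ×
    (∃ λ N → ∀ i → N ℕ.≤ i → ∣ seq x i ∣ ℚ.≤ B)
  eventually-bounded x =
    let (N , close) = cauchy x 1ℚ (ℚ.positive⁻¹ 1ℚ)
    in 1ℚ ℚ.+ ∣ seq x N ∣
     , ℚ.+-mono-<-≤ (ℚ.positive⁻¹ 1ℚ) (ℚ.0≤∣p∣ (seq x N))
     , N , λ i i≥ → begin
      ∣ seq x i ∣
        ≡⟨ cong ∣_∣ (split (seq x i) (seq x N)) ⟩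
      ∣ (seq x i ℚ.- seq x N) ℚ.+ seq x N ∣
        ≤⟨ ℚ.∣p+q∣≤∣p∣+∣q∣ (seq x i ℚ.- seq x N) (seq x N) ⟩
      ∣ seq x i ℚ.- seq x N ∣ ℚ.+ ∣ seq x N ∣
        ≤⟨ ℚ.+-monoˡ-≤ ∣ seq x N ∣ (close i N i≥ ℕ.≤-refl) ⟩
      1ℚ ℚ.+ ∣ seq x N ∣ ∎
    where
    open ℚ.≤-Reasoning
    split : ∀ a b → a ≡ (a ℚ.- b) ℚ.+ b
    split = solve 2 (λ a b → a := (a :+ (:- b)) :+ b) refl

  *-mono-≤-abs : ∀ a b {c d} → 0ℚ ℚ.< c → ∣ a ∣ ℚ.≤ c → ∣ b ∣ ℚ.≤ d →
    ∣ a ∣ ℚ.* ∣ b ∣ ℚ.≤ c ℚ.* d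
  *-mono-≤-abs a b {c} 0<c a≤c b≤d = ℚ.≤-trans
    (ℚ.*-monoʳ-≤-nonNeg ∣ b ∣ {{ℚ.nonNegative (ℚ.0≤∣p∣ b)}} a≤c)
    (ℚ.*-monoˡ-≤-nonNeg c {{ℚ.nonNegative (ℚ.<⇒≤ 0<c)}} b≤d)

  *-cauchy : ∀ x y → Cauchy (λ i → seq x i ℚ.* seq y i)
  *-cauchy x y ε 0<ε =
    let (A , 0<A , K , x-bd) = eventually-bounded x
        (B , 0<B , L , y-bd) = eventually-bounded y
        A+B-pos = ℚ.positive (ℚ.+-mono-< 0<A 0<B)
        A+B-nz  = ℚ.pos⇒nonZero (A ℚ.+ B) {{A+B-pos}}
        inv     = (ℚ.1/ (A ℚ.+ B)) {{A+B-nz}}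
        inv-pos = ℚ.1/pos⇒pos (A ℚ.+ B) {{A+B-pos}}
        δ       = inv ℚ.* ε
        0<δ     = ℚ.positive⁻¹ δ
                    {{ℚ.pos*pos⇒pos inv {{inv-pos}} ε {{ℚ.positive 0<ε}}}}
        (M , x-close) = cauchy x δ 0<δ
        (N , y-close) = cauchy y δ 0<δ
        [A+B]δ≡ε : (A ℚ.+ B) ℚ.* δ ≡ ε
        [A+B]δ≡ε = trans (sym (ℚ.*-assoc (A ℚ.+ B) inv ε))
          (trans (cong (ℚ._* ε) (ℚ.*-inverseʳ (A ℚ.+ B) {{A+B-nz}}))
                 (ℚ.*-identityˡ ε))
        KL = K ℕ.⊔ L
        MN = M ℕ.⊔ N
    in KL ℕ.⊔ MN , λ i j i≥ j≥ →
      let i≥KL = ℕ.m⊔n≤o⇒m≤o KL MN i≥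
          j≥KL = ℕ.m⊔n≤o⇒m≤o KL MN j≥
          i≥MN = ℕ.m⊔n≤o⇒n≤o KL MN i≥
          j≥MN = ℕ.m⊔n≤o⇒n≤o KL MN j≥
          a = seq x i ; b = seq y i ; c = seq x j ; d = seq y j
      in begin
      ∣ a ℚ.* b ℚ.- c ℚ.* d ∣
        ≡⟨ cong ∣_∣ (rearrange a b c d) ⟩
      ∣ a ℚ.* (b ℚ.- d) ℚ.+ d ℚ.* (a ℚ.- c) ∣
        ≤⟨ ℚ.∣p+q∣≤∣p∣+∣q∣ (a ℚ.* (b ℚ.- d)) (d ℚ.* (a ℚ.- c)) ⟩
      ∣ a ℚ.* (b ℚ.- d) ∣ ℚ.+ ∣ d ℚ.* (a ℚ.- c) ∣
        ≡⟨ cong₂ ℚ._+_ (ℚ.∣p*q∣≡∣p∣*∣q∣ a (b ℚ.- d))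
                       (ℚ.∣p*q∣≡∣p∣*∣q∣ d (a ℚ.- c)) ⟩
      ∣ a ∣ ℚ.* ∣ b ℚ.- d ∣ ℚ.+ ∣ d ∣ ℚ.* ∣ a ℚ.- c ∣
        ≤⟨ ℚ.+-mono-≤
             (*-mono-≤-abs a (b ℚ.- d) 0<A
               (x-bd i (ℕ.m⊔n≤o⇒m≤o K L i≥KL))
               (y-close i j (ℕ.m⊔n≤o⇒n≤o M N i≥MN) (ℕ.m⊔n≤o⇒n≤o M N j≥MN)))
             (*-mono-≤-abs d (a ℚ.- c) 0<B
               (y-bd j (ℕ.m⊔n≤o⇒n≤o K L j≥KL))
               (x-close i j (ℕ.m⊔n≤o⇒m≤o M N i≥MN) (ℕ.m⊔n≤o⇒m≤o M N j≥MN))) ⟩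
      A ℚ.* δ ℚ.+ B ℚ.* δ
        ≡⟨ sym (ℚ.*-distribʳ-+ δ A B) ⟩
      (A ℚ.+ B) ℚ.* δ
        ≡⟨ [A+B]δ≡ε ⟩
      ε ∎
    where
    open ℚ.≤-Reasoning
    rearrange : ∀ a b c d →
      a ℚ.* b ℚ.- c ℚ.* d ≡ a ℚ.* (b ℚ.- d) ℚ.+ d ℚ.* (a ℚ.- c)
    rearrange = solve 4 (λ a b c d →
      (a :* b) :+ (:- (c :* d)) :=
      (a :* (b :+ (:- d))) :+ (d :* (a :+ (:- c)))) refl

fromℚ : ℚ → ℝ
fromℚ q = mkℝ (λ _ → q) λ ε 0<ε →
  0 , λ _ _ _ _ → subst (ℚ._≤ ε) (sym (∣p-p∣≡0 q)) (ℚ.<⇒≤ 0<ε)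

fromℕ : ℕ → ℝ
fromℕ n = fromℚ (+ n ℚ./ 1)

0ℝ 1ℝ : ℝ
0ℝ = fromℕ 0
1ℝ = fromℕ 1

infixl 6 _+_ _-_
infixl 7 _*_ _÷_
infixr 8 _^_
infix  8 -_
infix  4 _≈_ _≤_ _<_ _⟶_

_+_ : ℝ → ℝ → ℝ
x + y = mkℝ (λ i → seq x i ℚ.+ seq y i) (+-cauchy x y)

-_ : ℝ → ℝ
- x = mkℝ (λ i → ℚ.- seq x i) (neg-cauchy x)

_-_ : ℝ → ℝ → ℝ
x - y = x + (- y)

_*_ : ℝ → ℝ → ℝ
x * y = mkℝ (λ i → seq x i ℚ.* seq y i) (*-cauchy x y)

_÷_ : ℝ → (n : ℕ) → .{{ℕ.NonZero n}} → ℝ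
x ÷ n = x * fromℚ (+ 1 ℚ./ n)

_^_ : ℝ → ℕ → ℝ
x ^ zero  = 1ℝ
x ^ suc k = x * x ^ k

_≈_ : ℝ → ℝ → Set
x ≈ y = ∀ ε → 0ℚ ℚ.< ε →
  ∃ λ N → ∀ i → N ℕ.≤ i → ∣ seq x i ℚ.- seq y i ∣ ℚ.≤ ε

_≤_ : ℝ → ℝ → Set
x ≤ y = ∀ ε → 0ℚ ℚ.< ε →
  ∃ λ N → ∀ i → N ℕ.≤ i → seq x i ℚ.≤ seq y i ℚ.+ ε

_<_ : ℝ → ℝ → Set
x < y = Σ[ ε ∈ ℚ ] (0ℚ ℚ.< ε) ×
  (∃ λ N → ∀ i → N ℕ.≤ i → seq x i ℚ.+ ε ℚ.≤ seq y i)

_⟶_ : (ℕ → ℝ) → ℝ → Set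
s ⟶ l = ∀ ε → 0ℚ ℚ.< ε →
  ∃ λ N → ∀ m → N ℕ.≤ m → (s m ≤ l + fromℚ ε) × (l ≤ s m + fromℚ ε)

-- y = eˣ, the limit of (1 + x/m)ᵐ over m ≥ 1.
IsExp : ℝ → ℝ → Set
IsExp x y = (λ m → (1ℝ + x ÷ suc m) ^ suc m) ⟶ y

-- y = ln x.
IsLn : ℝ → ℝ → Set
IsLn x y = IsExp y x

-- y is the k-th root of x, for x ≥ 0 and k ≥ 1.
IsRoot : ℕ → ℝ → ℝ → Set
IsRoot k x y = (0ℝ ≤ y) × (y ^ k ≈ x)

------------------------------------------------------------------------
-- Finite probability distributions

-- Outcomes paired with their probabilities; an outcome may be listed
-- several times.
Dist : Set → Set
Dist A = List (A × ℝ)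

return : {A : Set} → A → Dist A
return a = (a , 1ℝ) ∷ []

_>>=_ : {A B : Set} → Dist A → (A → Dist B) → Dist B
d >>= k = concatMap (λ (a , v) → map (λ (b , w) → b , v * w) (k a)) d

bernoulli : ℝ → Dist Bool
bernoulli p = (true , p) ∷ (false , 1ℝ - p) ∷ []

-- Uniform on {1, …, α}.
uniform : (α : ℕ) → .{{ℕ.NonZero α}} → Dist ℕ
uniform α = map (λ l → suc l , 1ℝ ÷ α) (upTo α)

ℙ : {A : Set} → Dist A → (A → Bool) → ℝ
ℙ d E = foldr _+_ 0ℝ (map proj₂ (filterᵇ (λ (a , _) → E a) d))

-- An event involving real inequalities need not be decidable, so its
-- probability is bounded below through a decidable event contained in it.
-- For a decidable event with nonnegative weights this is b ≤ ℙ d E.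
ProbabilityAtLeast : {A : Set} → ℝ → Dist A → (A → Set) → Set
ProbabilityAtLeast {A} b d E =
  Σ[ D ∈ (A → Bool) ] (∀ a → T (D a) → E a) × (b ≤ ℙ d D)

------------------------------------------------------------------------
-- Random labelled graphs on the vertex set Fin n

-- An undirected edge is listed once, smaller endpoint first.
Edge : ℕ → Set
Edge n = Fin n × Fin n

TimeEdge : ℕ → Set
TimeEdge n = Edge n × ℕ

Graph : ℕ → Set
Graph n = List (Edge n)

TemporalGraph : ℕ → Set
TemporalGraph n = List (TimeEdge n)

possibleEdges : ∀ n → List (Edge n)
possibleEdges n =
  filter (λ (i , j) → i <? j) (cartesianProduct (allFin n) (allFin n))

keepEach : {A : Set} → ℝ → List A → Dist (List A)
keepEach p []       = return []
keepEach p (e ∷ es) = do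
  present ← bernoulli p
  kept    ← keepEach p es
  return (if present then e ∷ kept else kept)

G⟨_,_⟩ : (n : ℕ) → ℝ → Dist (Graph n)
G⟨ n , p ⟩ = keepEach p (possibleEdges n)

labelUniformly : ∀ {n} (α : ℕ) → .{{ℕ.NonZero α}} → Graph n →
  Dist (TemporalGraph n)
labelUniformly α []       = return []
labelUniformly α (e ∷ es) = do
  l      ← uniform α
  others ← labelUniformly α es
  return ((e , l) ∷ others)

labelledG : (n : ℕ) → ℝ → (α : ℕ) → .{{ℕ.NonZero α}} →
  Dist (TemporalGraph n)
labelledG n p α = G⟨ n , p ⟩ >>= labelUniformly α

------------------------------------------------------------------------
-- Temporal connectivity

module _ {n : ℕ} where

  data Walk (S : TemporalGraph n) : Fin n → Fin n → Set where
    stop : ∀ {u} → Walk S u u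
    step : ∀ {u w v} (l : ℕ) →
           (((u , w) , l) ∈ S) ⊎ (((w , u) , l) ∈ S) →
           Walk S w v → Walk S u v

  vertices : ∀ {S u v} → Walk S u v → List (Fin n)
  vertices {u = u} stop         = u ∷ []
  vertices {u = u} (step _ _ w) = u ∷ vertices w

  labels : ∀ {S u v} → Walk S u v → List ℕ
  labels stop         = []
  labels (step l _ w) = l ∷ labels w

  record Journey (S : TemporalGraph n) (u v : Fin n) : Set where
    field
      walk       : Walk S u v
      path       : Unique (vertices walk)
      increasing : Linked ℕ._<_ (labels walk)

  TC : TemporalGraph n → Set
  TC S = ∀ u v → u ≢ v → Journey S u v

  -- The least number of time-edges of I that suffice for temporal
  -- connectivity is m.  The time-edges of a random instance are distinct,
  -- so its sublists are its subsets.
  Needs : TemporalGraph n → ℕ → Set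
  Needs I m =
    (Σ[ S ∈ TemporalGraph n ] (S ⊆ I) × TC S × (length S ≡ m)) ×
    (∀ S → S ⊆ I → TC S → m ℕ.≤ length S)

{-# OPTIONS --safe #-}
module Submission where

-- Since p ≤ 1, the quantity n + np⁵ has order n, so it is enough that a
-- linear number of time-edges suffices (that it is needed is clear, because
-- every vertex must be an endpoint).  Split the labels into four consecutive
-- windows of length ⌊α/4⌋ ≥ α/7 and fix a vertex h.  With high probability
-- every u ≠ h has a neighbour w with uw labelled in window 0 and wh in window 1,
-- and a neighbour w′ with hw′ labelled in window 2 and w′u in window 3; these
-- at most 4n time-edges connect everything through h.  For a fixed u the
-- n - 2 candidates w are independent and each succeeds with probability at
-- least (p/7)², so the failure probability is (1 - (p/7)²)ⁿ⁻² ≤ n⁻², as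
-- p⁷ is at least of order 1/n.  A union bound gives the claim with γ′ = 1.
--
-- The expectation over the random graph is computed over ℚ, index by index
-- in the sequence defining p; entries of that sequence exceeding 1 are
-- handled by continuity.

open import Data.Bool.Base using (Bool; true; false; if_then_else_; T; _∧_; not)
open import Data.Bool.Properties using (T-∧; T-≡)
open import Data.Empty using (⊥-elim; ⊥)
open import Data.Fin.Base as Fin using (Fin; zero; suc; punchIn)
import Data.Fin.Properties as Fin
import Data.Integer.Base as ℤ
import Data.Integer.Properties as ℤ
open import Data.List.Base
  using (List; []; _∷_; map; _++_; upTo; applyUpTo; length; concatMap; allFin; foldr;
         filterᵇ)
open import Data.List.Membership.Propositional using (_∈_; find; lose)
open import Data.List.Membership.Propositional.Properties
  using (∈-filter⁺; ∈-cartesianProduct⁺; ∈-allFin; ∈-map⁻; ∈-++⁺ˡ; ∈-++⁺ʳ)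
open import Data.List.Properties
  using (length-applyUpTo; length-map; length-tabulate; map-++; map-∘)
open import Data.List.Relation.Binary.Sublist.Propositional using (_⊆_; []; _∷ʳ_; _∷_; minimum)
open import Data.List.Relation.Unary.All as All using (All; []; _∷_)
open import Data.List.Relation.Unary.All.Properties using (¬Any⇒All¬)
import Data.List.Relation.Unary.All.Properties as All
open import Data.List.Relation.Unary.AllPairs using ([]; _∷_)
open import Data.List.Relation.Unary.Any as Any using (Any; here; there; any?)
import Data.List.Relation.Unary.Any.Properties as Any
open import Data.List.Relation.Unary.Linked using (Linked; []; [-]; _∷_)
open import Data.List.Relation.Unary.Unique.Propositional using (Unique)
import Data.List.Relation.Unary.Unique.Propositional.Properties as Unique
open import Data.Nat.Base as ℕ using (ℕ; zero; suc; s≤s; z≤n)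
import Data.Nat.DivMod as ℕ
import Data.Nat.Properties as ℕ
open import Data.Product using (_×_; _,_; proj₁; proj₂; ∃; ∃₂; Σ-syntax; map₂)
open import Data.Product.Properties using (≡-dec; ,-injectiveˡ; ,-injectiveʳ)
import Data.Rational.Unnormalised.Base as ℚᵘ
import Data.Rational.Unnormalised.Properties as ℚᵘ
open import Data.Sum.Base using (inj₁; inj₂; _⊎_; [_,_]′)
open import Data.Unit.Base using (tt)
import Defs as R
open import Function.Base using (_∘_; id)
open import Function.Bundles using (Equivalence)
open import Relation.Binary.Definitions using (DecidableEquality)
open import Relation.Binary.PropositionalEquality
open import Relation.Nullary using (does; yes; no; Dec; isYes)
open import Relation.Nullary.Decidable using (map′; _×-dec_; _⊎-dec_; _→-dec_; ¬?; toWitness)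
open import Relation.Nullary.Decidable.Core using (dec⇒maybe)
open import Relation.Unary using (Decidable)
open import Tactic.RingSolver using (solve-∀)
open import Tactic.RingSolver.Core.AlmostCommutativeRing
  using (AlmostCommutativeRing; fromCommutativeRing)

-- For a fixed u the candidates w use disjoint pairs of edges, so the indicator that all of them
-- fail is a product of factors 1 - xy, of degree one in each edge variable. The expectation of such
-- a polynomial is its value at the means, an identity valid for every rational p; this replaces any
-- formal notion of independence. Constants: from γ ≥ 3 and ln n ≥ ½ the seventh root r satisfies r⁷
-- ≥ 3/(2n). Reading real inequalities at single indices costs 1/(2n) each, which leaves r⁷ ≥ 1/n
-- and p ≥ 6r; as 3(6/7)⁷ > 1, this gives (p/7)⁷ ≥ 1/(3n). The tail estimate starts from this power
-- bound and uses the seventh power of Bernoulli's inequality where one would expect an exponential.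
-- Two obligations are constructive in nature. `Needs` asks for an exact minimum, so temporal
-- connectivity is decided and all sublists are searched. And n to the power -γ′ must be exhibited
-- as a limit of compound-interest terms; for γ′ = 1 it is 1/n, obtained by showing that the terms
-- for ln n and for -ln n have product close to 1.

-- Rational arithmetic, Bernoulli's inequality and the tail bound.

module Rationals where

  open import Data.Integer.Base using (+_)
  open import Data.Rational.Base
  open import Data.Rational.Properties
  open import Algebra.Bundles using (CommutativeRing)
  open import Algebra.Properties.CommutativeSemiring.Exp
    (CommutativeRing.commutativeSemiring +-*-commutativeRing) public
    using (_^_; ^-homo-*; ^-assocʳ; ^-distrib-*)

  ℚ-ring : AlmostCommutativeRing _ _
  ℚ-ring = fromCommutativeRing +-*-commutativeRing λ x → dec⇒maybe (0ℚ ≟ x)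

  0≤1 : 0ℚ ≤ 1ℚ
  0≤1 = nonNegative⁻¹ 1ℚ

  0≤-* : ∀ {p q} → 0ℚ ≤ p → 0ℚ ≤ q → 0ℚ ≤ p * q
  0≤-* {p} {q} 0≤p 0≤q =
    nonNegative⁻¹ (p * q) {{nonNeg*nonNeg⇒nonNeg p {{nonNegative 0≤p}} q {{nonNegative 0≤q}}}}

  0<-* : ∀ {p q} → 0ℚ < p → 0ℚ < q → 0ℚ < p * q
  0<-* {p} {q} 0<p 0<q =
    positive⁻¹ (p * q) {{pos*pos⇒pos p {{positive 0<p}} q {{positive 0<q}}}}

  0≤-+ : ∀ {p q} → 0ℚ ≤ p → 0ℚ ≤ q → 0ℚ ≤ p + q
  0≤-+ = +-mono-≤

  *-monoʳ : ∀ {r p q} → 0ℚ ≤ r → p ≤ q → r * p ≤ r * q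
  *-monoʳ {r} 0≤r = *-monoˡ-≤-nonNeg r {{nonNegative 0≤r}}

  *-monoˡ : ∀ {r p q} → 0ℚ ≤ r → p ≤ q → p * r ≤ q * r
  *-monoˡ {r} 0≤r = *-monoʳ-≤-nonNeg r {{nonNegative 0≤r}}

  *-mono : ∀ {p q r s} → 0ℚ ≤ p → 0ℚ ≤ s → p ≤ q → r ≤ s → p * r ≤ q * s
  *-mono 0≤p 0≤s p≤q r≤s = ≤-trans (*-monoʳ 0≤p r≤s) (*-monoˡ 0≤s p≤q)

  *-cancel : ∀ {r p q} → 0ℚ < r → p * r ≤ q * r → p ≤ q
  *-cancel {r} 0<r = *-cancelʳ-≤-pos r {{positive 0<r}}

  ≤-by : ∀ {p q} r → 0ℚ ≤ r → q ≡ p + r → p ≤ q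
  ≤-by {p} r 0≤r refl = subst (_≤ p + r) (+-identityʳ p) (+-monoʳ-≤ p 0≤r)

  ≤⇒0≤- : ∀ {p q} → p ≤ q → 0ℚ ≤ q - p
  ≤⇒0≤- {p} {q} p≤q = subst (_≤ q - p) (+-inverseʳ p) (+-monoˡ-≤ (- p) p≤q)

  0≤-⇒≤ : ∀ {p q} → 0ℚ ≤ q - p → p ≤ q
  0≤-⇒≤ {p} {q} h = ≤-by (q - p) h (lem p q)
    where
    lem : ∀ p q → q ≡ p + (q - p)
    lem = solve-∀ ℚ-ring

  0≤-² : ∀ p → 0ℚ ≤ p * p
  0≤-² p with ≤-total 0ℚ p
  ... | inj₁ 0≤p = 0≤-* 0≤p 0≤p
  ... | inj₂ p≤0 = subst (0ℚ ≤_) (lem p) (0≤-* (neg-antimono-≤ p≤0) (neg-antimono-≤ p≤0))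
    where
    lem : ∀ p → (- p) * (- p) ≡ p * p
    lem = solve-∀ ℚ-ring

  ι : ℕ → ℚ
  ι n = + n / 1

  1/ₙ : ∀ n → .{{ℕ.NonZero n}} → ℚ
  1/ₙ n = + 1 / n

  private
    toℚᵘ-ι : ∀ n → toℚᵘ (ι n) ℚᵘ.≃ ℚᵘ.mkℚᵘ (+ n) 0
    toℚᵘ-ι n = toℚᵘ-fromℚᵘ (ℚᵘ.mkℚᵘ (+ n) 0)

  ι-+ : ∀ m n → ι (m ℕ.+ n) ≡ ι m + ι n
  ι-+ m n = toℚᵘ-injective (begin
    toℚᵘ (ι (m ℕ.+ n))            ≈⟨ toℚᵘ-ι (m ℕ.+ n) ⟩
    ℚᵘ.mkℚᵘ (+ (m ℕ.+ n)) 0       ≈⟨ ℚᵘ.*≡* (cong (ℤ._* + 1) (trans (ℤ.pos-+ m n) (cong₂ ℤ._+_ (sym (ℤ.*-identityʳ (+ m))) (sym (ℤ.*-identityʳ (+ n)))))) ⟩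
    ℚᵘ.mkℚᵘ (+ m) 0 ℚᵘ.+ ℚᵘ.mkℚᵘ (+ n) 0 ≈⟨ ℚᵘ.+-cong (toℚᵘ-ι m) (toℚᵘ-ι n) ⟨
    toℚᵘ (ι m) ℚᵘ.+ toℚᵘ (ι n)    ≈⟨ toℚᵘ-homo-+ (ι m) (ι n) ⟨
    toℚᵘ (ι m + ι n)              ∎)
    where open ℚᵘ.≃-Reasoning

  ι-* : ∀ m n → ι (m ℕ.* n) ≡ ι m * ι n
  ι-* m n = toℚᵘ-injective (begin
    toℚᵘ (ι (m ℕ.* n))            ≈⟨ toℚᵘ-ι (m ℕ.* n) ⟩
    ℚᵘ.mkℚᵘ (+ (m ℕ.* n)) 0       ≈⟨ ℚᵘ.*≡* (cong (ℤ._* + 1) (ℤ.pos-* m n)) ⟩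
    ℚᵘ.mkℚᵘ (+ m) 0 ℚᵘ.* ℚᵘ.mkℚᵘ (+ n) 0 ≈⟨ ℚᵘ.*-cong (toℚᵘ-ι m) (toℚᵘ-ι n) ⟨
    toℚᵘ (ι m) ℚᵘ.* toℚᵘ (ι n)    ≈⟨ toℚᵘ-homo-* (ι m) (ι n) ⟨
    toℚᵘ (ι m * ι n)              ∎)
    where open ℚᵘ.≃-Reasoning

  ι-suc : ∀ n → ι (suc n) ≡ 1ℚ + ι n
  ι-suc = ι-+ 1

  ι-^ : ∀ m n → ι (m ℕ.^ n) ≡ ι m ^ n
  ι-^ m zero    = refl
  ι-^ m (suc n) = trans (ι-* m (m ℕ.^ n)) (cong (ι m *_) (ι-^ m n))

  0≤ι : ∀ n → 0ℚ ≤ ι n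
  0≤ι n = nonNegative⁻¹ (ι n) {{normalize-nonNeg n 1}}

  0<ι : ∀ n → .{{ℕ.NonZero n}} → 0ℚ < ι n
  0<ι n = positive⁻¹ (ι n) {{normalize-pos n 1}}

  0<1/ₙ : ∀ n → .{{_ : ℕ.NonZero n}} → 0ℚ < 1/ₙ n
  0<1/ₙ n = positive⁻¹ (1/ₙ n) {{normalize-pos 1 n}}

  0≤1/ₙ : ∀ n → .{{_ : ℕ.NonZero n}} → 0ℚ ≤ 1/ₙ n
  0≤1/ₙ n = <⇒≤ (0<1/ₙ n)

  ι-mono : ∀ {m n} → m ℕ.≤ n → ι m ≤ ι n
  ι-mono {m} {n} m≤n = ≤-by (ι (n ℕ.∸ m)) (0≤ι (n ℕ.∸ m))
    (trans (cong ι (sym (ℕ.m+[n∸m]≡n m≤n))) (ι-+ m (n ℕ.∸ m)))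

  ι*1/ₙ : ∀ n → .{{_ : ℕ.NonZero n}} → ι n * 1/ₙ n ≡ 1ℚ
  ι*1/ₙ (suc n) = toℚᵘ-injective (begin
    toℚᵘ (ι (suc n) * 1/ₙ (suc n))                  ≈⟨ toℚᵘ-homo-* (ι (suc n)) (1/ₙ (suc n)) ⟩
    toℚᵘ (ι (suc n)) ℚᵘ.* toℚᵘ (1/ₙ (suc n))        ≈⟨ ℚᵘ.*-cong (toℚᵘ-ι (suc n)) (toℚᵘ-fromℚᵘ (ℚᵘ.mkℚᵘ (+ 1) n)) ⟩
    ℚᵘ.mkℚᵘ (+ (suc n)) 0 ℚᵘ.* ℚᵘ.mkℚᵘ (+ 1) n      ≈⟨ ℚᵘ.*-inverseʳ (ℚᵘ.mkℚᵘ (+ suc n) 0) ⟩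
    ℚᵘ.1ℚᵘ                                          ∎)
    where open ℚᵘ.≃-Reasoning

  ^-nonneg : ∀ {x} n → 0ℚ ≤ x → 0ℚ ≤ x ^ n
  ^-nonneg zero    0≤x = 0≤1
  ^-nonneg (suc n) 0≤x = 0≤-* 0≤x (^-nonneg n 0≤x)

  ^-mono : ∀ {x y} n → 0ℚ ≤ x → x ≤ y → x ^ n ≤ y ^ n
  ^-mono zero    0≤x x≤y = ≤-refl
  ^-mono (suc n) 0≤x x≤y =
    *-mono 0≤x (^-nonneg n (≤-trans 0≤x x≤y)) x≤y (^-mono n 0≤x x≤y)

  ^-≤1 : ∀ {x} n → 0ℚ ≤ x → x ≤ 1ℚ → x ^ n ≤ 1ℚ
  ^-≤1 zero    0≤x x≤1 = ≤-refl
  ^-≤1 (suc n) 0≤x x≤1 = *-mono 0≤x 0≤1 x≤1 (^-≤1 n 0≤x x≤1)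

  1≤^ : ∀ {x} n → 1ℚ ≤ x → 1ℚ ≤ x ^ n
  1≤^ zero    1≤x = ≤-refl
  1≤^ (suc n) 1≤x = *-mono 0≤1 (≤-trans 0≤1 1≤x^n) 1≤x 1≤x^n
    where 1≤x^n = 1≤^ n 1≤x

  ^-monoʳ : ∀ {x m n} → 1ℚ ≤ x → m ℕ.≤ n → x ^ m ≤ x ^ n
  ^-monoʳ {n = n} 1≤x ℕ.z≤n       = 1≤^ n 1≤x
  ^-monoʳ {n = suc n} 1≤x (ℕ.s≤s m≤n) = *-monoʳ (≤-trans 0≤1 1≤x) (^-monoʳ 1≤x m≤n)

  bernoulli-≤ : ∀ {x} n → - 1ℚ ≤ x → 1ℚ + ι n * x ≤ (1ℚ + x) ^ n
  bernoulli-≤ {x} zero    -1≤x = ≤-reflexive (lem x)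
    where
    lem : ∀ x → 1ℚ + 0ℚ * x ≡ 1ℚ
    lem = solve-∀ ℚ-ring
  bernoulli-≤ {x} (suc n) -1≤x = ≤-trans
    (≤-by (ι n * (x * x)) (0≤-* (0≤ι n) (0≤-² x))
      (trans (lem (ι n) x) (cong (λ z → 1ℚ + z * x + ι n * (x * x)) (sym (ι-suc n)))))
    (*-monoʳ (subst (0ℚ ≤_) (lem′ x) (≤⇒0≤- -1≤x)) (bernoulli-≤ n -1≤x))
    where
    lem : ∀ a x → (1ℚ + x) * (1ℚ + a * x) ≡ 1ℚ + (1ℚ + a) * x + a * (x * x)
    lem = solve-∀ ℚ-ring
    lem′ : ∀ x → x - - 1ℚ ≡ 1ℚ + x
    lem′ = solve-∀ ℚ-ring

  -- An upper bound on the exponential that needs no convergence argument: 1 - nx ≤ (1 + x)⁻ⁿ.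
  ^*[1-n*x]≤1 : ∀ {x} n → 0ℚ ≤ x → (1ℚ + x) ^ n * (1ℚ - ι n * x) ≤ 1ℚ
  ^*[1-n*x]≤1 {x} zero    0≤x = ≤-reflexive (lem x)
    where
    lem : ∀ x → 1ℚ * (1ℚ - 0ℚ * x) ≡ 1ℚ
    lem = solve-∀ ℚ-ring
  ^*[1-n*x]≤1 {x} (suc n) 0≤x = ≤-trans
    (≤-by (P * (ι (suc n) * (x * x)))
      (0≤-* (^-nonneg n (0≤-+ 0≤1 0≤x)) (0≤-* (0≤ι (suc n)) (0≤-² x)))
      (trans (lem P (ι n) x)
        (cong (λ z → (1ℚ + x) * P * (1ℚ - z * x) + P * (z * (x * x))) (sym (ι-suc n)))))
    (^*[1-n*x]≤1 n 0≤x)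
    where
    P = (1ℚ + x) ^ n
    lem : ∀ P a x → P * (1ℚ - a * x) ≡
      (1ℚ + x) * P * (1ℚ - (1ℚ + a) * x) + P * ((1ℚ + a) * (x * x))
    lem = solve-∀ ℚ-ring

  -- Stands in for (1 - y)ⁿ ≤ e⁻ⁿʸ: the product is (1 - y²)ⁿ, and (1 + y)ⁿ is easy to bound from
  -- below.
  [1-y]^n*[1+y]^n≤1 : ∀ {y} n → 0ℚ ≤ y → y ≤ 1ℚ → (1ℚ - y) ^ n * (1ℚ + y) ^ n ≤ 1ℚ
  [1-y]^n*[1+y]^n≤1 {y} n 0≤y y≤1 = subst (_≤ 1ℚ) (^-distrib-* (1ℚ - y) (1ℚ + y) n)
    (^-≤1 n (0≤-* (≤⇒0≤- y≤1) (0≤-+ 0≤1 0≤y)) (≤-by (y * y) (0≤-² y) (lem y)))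
    where
    lem : ∀ y → 1ℚ ≡ (1ℚ - y) * (1ℚ + y) + y * y
    lem = solve-∀ ℚ-ring

  -- Bernoulli gives my ≤ (1 + y)ᵐ. Its seventh power, m⁷y⁷ ≤ (1 + y)⁷ᵐ ≤ (1 + y)ᵏ, is absorbed by
  -- (1 - y)ᵏ, and the lower bound on y⁷ then trades y⁷ for the factor `c`.
  geometric-tail : ∀ {y} m k c →
    0ℚ ≤ y → y ≤ 1ℚ → 7 ℕ.* m ℕ.≤ k → 1ℚ ≤ ι c * y ^ 7 →
    ι (m ℕ.^ 7) * (1ℚ - y) ^ k ≤ ι c
  geometric-tail {y} m k c 0≤y y≤1 7m≤k 1≤cy⁷ = begin
    ι (m ℕ.^ 7) * Q                       ≡⟨ cong (_* Q) (ι-^ m 7) ⟩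
    ι m ^ 7 * Q                           ≡⟨ *-identityˡ _ ⟨
    1ℚ * (ι m ^ 7 * Q)                    ≤⟨ *-monoˡ (0≤-* (^-nonneg 7 (0≤ι m)) 0≤Q) 1≤cy⁷ ⟩
    ι c * y ^ 7 * (ι m ^ 7 * Q)           ≡⟨ lem (ι c) (y ^ 7) (ι m ^ 7) Q ⟩
    ι c * (Q * (ι m ^ 7 * y ^ 7))         ≤⟨ *-monoʳ (0≤ι c) (≤-trans (*-monoʳ 0≤Q step) ([1-y]^n*[1+y]^n≤1 k 0≤y y≤1)) ⟩
    ι c * 1ℚ                              ≡⟨ *-identityʳ (ι c) ⟩
    ι c                                   ∎
    where
    open ≤-Reasoning
    Q = (1ℚ - y) ^ k
    0≤Q : 0ℚ ≤ Q
    0≤Q = ^-nonneg k (≤⇒0≤- y≤1)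
    lem : ∀ c y m q → c * y * (m * q) ≡ c * (q * (m * y))
    lem = solve-∀ ℚ-ring
    step : ι m ^ 7 * y ^ 7 ≤ (1ℚ + y) ^ k
    step = begin
      ι m ^ 7 * y ^ 7         ≡⟨ ^-distrib-* (ι m) y 7 ⟨
      (ι m * y) ^ 7           ≤⟨ ^-mono 7 (0≤-* (0≤ι m) 0≤y)
                                   (≤-trans (≤-by 1ℚ 0≤1 (+-comm 1ℚ (ι m * y))) (bernoulli-≤ m (≤-trans (nonPositive⁻¹ (- 1ℚ)) 0≤y))) ⟩
      ((1ℚ + y) ^ m) ^ 7      ≡⟨ ^-assocʳ (1ℚ + y) m 7 ⟩
      (1ℚ + y) ^ (m ℕ.* 7)    ≤⟨ ^-monoʳ (≤-by y 0≤y refl) (subst (ℕ._≤ k) (ℕ.*-comm 7 m) 7m≤k) ⟩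
      (1ℚ + y) ^ k            ∎

  private
    ^-distribʳ-* : ∀ a b n → (a ℕ.* b) ℕ.^ n ≡ a ℕ.^ n ℕ.* b ℕ.^ n
    ^-distribʳ-* a b zero    = refl
    ^-distribʳ-* a b (suc n) = trans (cong (a ℕ.* b ℕ.*_) (^-distribʳ-* a b n))
      (ℕ.[m*n]*[o*p]≡[m*o]*[n*p] a b (a ℕ.^ n) (b ℕ.^ n))

    -- Once n is replaced by 9m the claim is 9⁵ ≤ m³, and 9⁵ = 59049 ≤ 64000 = 40³. With m = ⌊n/8⌋
    -- this is the origin of the threshold 320 = 8 · 40.
    9n⁴≤m⁷ : ∀ {n m} → 40 ℕ.≤ m → n ℕ.≤ 9 ℕ.* m → 9 ℕ.* n ℕ.^ 4 ℕ.≤ m ℕ.^ 7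
    9n⁴≤m⁷ {n} {m} 40≤m n≤9m = begin
      9 ℕ.* n ℕ.^ 4               ≤⟨ ℕ.*-monoʳ-≤ 9 (ℕ.^-monoˡ-≤ 4 n≤9m) ⟩
      9 ℕ.* (9 ℕ.* m) ℕ.^ 4       ≡⟨ cong (9 ℕ.*_) (^-distribʳ-* 9 m 4) ⟩
      9 ℕ.* (9 ℕ.^ 4 ℕ.* m ℕ.^ 4) ≡⟨ ℕ.*-assoc 9 (9 ℕ.^ 4) (m ℕ.^ 4) ⟨
      9 ℕ.^ 5 ℕ.* m ℕ.^ 4         ≤⟨ ℕ.*-monoˡ-≤ (m ℕ.^ 4) (ℕ.≤-trans (ℕ.≤ᵇ⇒≤ (9 ℕ.^ 5) (40 ℕ.^ 3) _) (ℕ.^-monoˡ-≤ 3 40≤m)) ⟩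
      m ℕ.^ 3 ℕ.* m ℕ.^ 4         ≡⟨ ℕ.^-distribˡ-+-* m 3 4 ⟨
      m ℕ.^ 7                     ∎
      where open ℕ.≤-Reasoning

  -- geometric-tail with m = ⌊n/8⌋ and 9n⁴ ≤ m⁷.
  tail-≤ : ∀ {y} k → 320 ℕ.≤ 2 ℕ.+ k → 0ℚ ≤ y → y ≤ 1ℚ →
    1ℚ ≤ ι (9 ℕ.* (2 ℕ.+ k) ℕ.^ 2) * y ^ 7 →
    ι ((2 ℕ.+ k) ℕ.^ 2) * (1ℚ - y) ^ k ≤ 1ℚ
  tail-≤ {y} k 320≤n 0≤y y≤1 h = *-cancel 0<c (begin
    ι (n ℕ.^ 2) * Q * ι (9 ℕ.* n ℕ.^ 2)    ≡⟨ lem (ι (n ℕ.^ 2)) Q (ι (9 ℕ.* n ℕ.^ 2)) ⟩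
    ι (9 ℕ.* n ℕ.^ 2) * ι (n ℕ.^ 2) * Q    ≡⟨ cong (_* Q) (ι-* (9 ℕ.* n ℕ.^ 2) (n ℕ.^ 2)) ⟨
    ι (9 ℕ.* n ℕ.^ 2 ℕ.* n ℕ.^ 2) * Q      ≡⟨ cong (λ z → ι z * Q) (trans (ℕ.*-assoc 9 (n ℕ.^ 2) (n ℕ.^ 2)) (cong (9 ℕ.*_) (sym (ℕ.^-distribˡ-+-* n 2 2)))) ⟩
    ι (9 ℕ.* n ℕ.^ 4) * Q                  ≤⟨ *-monoˡ (^-nonneg k (≤⇒0≤- y≤1)) (ι-mono (9n⁴≤m⁷ 40≤m n≤9m)) ⟩
    ι (m ℕ.^ 7) * Q                        ≤⟨ geometric-tail m k (9 ℕ.* n ℕ.^ 2) 0≤y y≤1 7m≤k h ⟩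
    ι (9 ℕ.* n ℕ.^ 2)                      ≡⟨ *-identityˡ _ ⟨
    1ℚ * ι (9 ℕ.* n ℕ.^ 2)                 ∎)
    where
    open ≤-Reasoning
    n = 2 ℕ.+ k
    m = n ℕ./ 8
    Q = (1ℚ - y) ^ k
    lem : ∀ a q b → a * q * b ≡ b * a * q
    lem = solve-∀ ℚ-ring
    0<c : 0ℚ < ι (9 ℕ.* n ℕ.^ 2)
    0<c = 0<ι (9 ℕ.* n ℕ.^ 2) {{ℕ.m*n≢0 9 (n ℕ.^ 2) {{_}} {{ℕ.m^n≢0 n 2}}}}
    40≤m : 40 ℕ.≤ m
    40≤m = ℕ./-monoˡ-≤ 8 320≤n
    n<8+8m : n ℕ.< 8 ℕ.+ 8 ℕ.* m
    n<8+8m = subst₂ ℕ._<_ (sym (ℕ.m≡m%n+[m/n]*n n 8)) (cong (8 ℕ.+_) (ℕ.*-comm m 8))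
      (ℕ.+-monoˡ-< (m ℕ.* 8) (ℕ.m%n<n n 8))
    n≤9m : n ℕ.≤ 9 ℕ.* m
    n≤9m = ℕ.≤-trans (ℕ.<⇒≤ n<8+8m) (ℕ.+-monoˡ-≤ (8 ℕ.* m) (ℕ.≤-trans (ℕ.m≤m+n 8 32) 40≤m))
    7m≤k : 7 ℕ.* m ℕ.≤ k
    7m≤k = ℕ.+-cancelˡ-≤ 2 _ _ (ℕ.≤-trans
      (ℕ.+-monoˡ-≤ (7 ℕ.* m) (ℕ.≤-trans (ℕ.m≤m+n 2 38) 40≤m))
      (subst (ℕ._≤ n) (ℕ.*-comm m 8) (ℕ.m/n*n≤m n 8)))

-- Finite weighted sums and the expectation over labelled edges, for rational p.

module Expectation where

  open Rationals
  open import Data.Rational.Base hiding (_⊔_; _⊓_)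
  open import Data.Rational.Properties hiding (_≟_)

  private variable
    A B : Set

  ∑ : List (A × ℚ) → (A → ℚ) → ℚ
  ∑ []            f = 0ℚ
  ∑ ((a , w) ∷ d) f = w * f a + ∑ d f

  ∑-cong : ∀ (d : List (A × ℚ)) {f g} → (∀ a → f a ≡ g a) → ∑ d f ≡ ∑ d g
  ∑-cong []            f≗g = refl
  ∑-cong ((a , w) ∷ d) f≗g = cong₂ (λ x y → w * x + y) (f≗g a) (∑-cong d f≗g)

  ∑-+ : ∀ (d : List (A × ℚ)) f g → ∑ d (λ a → f a + g a) ≡ ∑ d f + ∑ d g
  ∑-+ []            f g = refl
  ∑-+ ((a , w) ∷ d) f g = trans
    (cong (w * (f a + g a) +_) (∑-+ d f g))
    (lem w (f a) (g a) (∑ d f) (∑ d g))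
    where
    lem : ∀ w x y s t → w * (x + y) + (s + t) ≡ (w * x + s) + (w * y + t)
    lem = solve-∀ ℚ-ring

  ∑-* : ∀ (d : List (A × ℚ)) c f → ∑ d (λ a → c * f a) ≡ c * ∑ d f
  ∑-* []            c f = sym (*-zeroʳ c)
  ∑-* ((a , w) ∷ d) c f = trans
    (cong (w * (c * f a) +_) (∑-* d c f))
    (lem w c (f a) (∑ d f))
    where
    lem : ∀ w c x s → w * (c * x) + c * s ≡ c * (w * x + s)
    lem = solve-∀ ℚ-ring

  ∑-0 : ∀ (d : List (A × ℚ)) → ∑ d (λ _ → 0ℚ) ≡ 0ℚ
  ∑-0 d = trans (sym (∑-cong d (λ _ → *-zeroˡ 0ℚ))) (trans (∑-* d 0ℚ (λ _ → 0ℚ)) (*-zeroˡ (∑ d (λ _ → 0ℚ))))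

  ∑-swap : ∀ (d : List (A × ℚ)) (e : List (B × ℚ)) (f : A → B → ℚ) →
    ∑ d (λ a → ∑ e (f a)) ≡ ∑ e (λ b → ∑ d (λ a → f a b))
  ∑-swap []            e f = sym (∑-0 e)
  ∑-swap ((a , w) ∷ d) e f = begin
    w * ∑ e (f a) + ∑ d (λ a → ∑ e (f a))                ≡⟨ cong₂ _+_ (∑-* e w (f a)) (sym (∑-swap d e f)) ⟨
    ∑ e (λ b → w * f a b) + ∑ e (λ b → ∑ d (λ a → f a b)) ≡⟨ ∑-+ e (λ b → w * f a b) _ ⟨
    ∑ e (λ b → w * f a b + ∑ d (λ a → f a b))            ∎
    where open ≡-Reasoning

  ∑-++ : ∀ (d e : List (A × ℚ)) f → ∑ (d ++ e) f ≡ ∑ d f + ∑ e f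
  ∑-++ []            e f = sym (+-identityˡ (∑ e f))
  ∑-++ ((a , w) ∷ d) e f = trans (cong (w * f a +_) (∑-++ d e f))
    (sym (+-assoc (w * f a) (∑ d f) (∑ e f)))

  ∑-1 : ∀ (ls : List B) (g : B → A) c → ∑ (map (λ b → g b , c) ls) (λ _ → 1ℚ) ≡ ι (length ls) * c
  ∑-1 []       g c = sym (*-zeroˡ c)
  ∑-1 (b ∷ ls) g c = trans (cong (c * 1ℚ +_) (∑-1 ls g c))
    (trans (lem c (ι (length ls))) (cong (_* c) (sym (ι-suc (length ls)))))
    where
    lem : ∀ c n → c * 1ℚ + n * c ≡ (1ℚ + n) * c
    lem = solve-∀ ℚ-ring

  ∑-nonneg : ∀ (ls : List B) (g : B → A) {c f} → 0ℚ ≤ c → (∀ a → 0ℚ ≤ f a) →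
    0ℚ ≤ ∑ (map (λ b → g b , c) ls) f
  ∑-nonneg []       g 0≤c 0≤f = ≤-refl
  ∑-nonneg (b ∷ ls) g 0≤c 0≤f = 0≤-+ (0≤-* 0≤c (0≤f (g b))) (∑-nonneg ls g 0≤c 0≤f)

  -- The map `g` generalises the identity: induction passes to the tail of `applyUpTo`, which turns
  -- `g` into `g ∘ suc`.
  ∑-window : ∀ n (g : ℕ → ℕ) {c f} a k → 0ℚ ≤ c → (∀ l → 0ℚ ≤ f l) →
    a ℕ.+ k ℕ.≤ n → (∀ i → a ℕ.≤ i → i ℕ.< a ℕ.+ k → f (suc (g i)) ≡ 1ℚ) →
    ι k * c ≤ ∑ (map (λ l → suc l , c) (applyUpTo g n)) f
  ∑-window n g {c} zero zero 0≤c 0≤f _ _ =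
    ≤-trans (≤-reflexive (*-zeroˡ c)) (∑-nonneg (applyUpTo g n) suc 0≤c 0≤f)
  ∑-window (suc n) g {c} {f} zero (suc k) 0≤c 0≤f (s≤s k≤n) h = begin
    ι (suc k) * c            ≡⟨ cong (_* c) (ι-suc k) ⟩
    (1ℚ + ι k) * c           ≡⟨ lem c (ι k) ⟩
    c * 1ℚ + ι k * c         ≡⟨ cong (λ z → c * z + ι k * c) (h 0 z≤n (s≤s z≤n)) ⟨
    c * f (suc (g 0)) + ι k * c
      ≤⟨ +-monoʳ-≤ (c * f (suc (g 0))) (∑-window n (g ∘ suc) zero k 0≤c 0≤f k≤n λ i _ i<k → h (suc i) z≤n (s≤s i<k)) ⟩
    c * f (suc (g 0)) + _    ∎
    where
    open ≤-Reasoning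
    lem : ∀ c k → (1ℚ + k) * c ≡ c * 1ℚ + k * c
    lem = solve-∀ ℚ-ring
  ∑-window (suc n) g {c} {f} (suc a) k 0≤c 0≤f (s≤s a+k≤n) h =
    ≤-trans (∑-window n (g ∘ suc) a k 0≤c 0≤f a+k≤n λ i a≤i i<a+k → h (suc i) (s≤s a≤i) (s≤s i<a+k))
      (≤-by (c * f (suc (g 0))) (0≤-* 0≤c (0≤f _)) (+-comm (c * f (suc (g 0))) _))

  module _ (α : ℕ) .{{_ : ℕ.NonZero α}} where

    -- The weight is left as `1ℚ * 1/ₙ α`, since this is what every entry of the real number
    -- `1ℝ ÷ α` computes to.
    uniformℚ : List (ℕ × ℚ)
    uniformℚ = map (λ l → suc l , 1ℚ * 1/ₙ α) (upTo α)

    0≤1*1/α : 0ℚ ≤ 1ℚ * 1/ₙ α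
    0≤1*1/α = 0≤-* 0≤1 (0≤1/ₙ α)

    mean : (ℕ → ℚ) → ℚ
    mean = ∑ uniformℚ

    mean-nonneg : ∀ {f} → (∀ l → 0ℚ ≤ f l) → 0ℚ ≤ mean f
    mean-nonneg = ∑-nonneg (upTo α) suc 0≤1*1/α

    mean-1 : mean (λ _ → 1ℚ) ≡ 1ℚ
    mean-1 = begin
      mean (λ _ → 1ℚ)                    ≡⟨ ∑-1 (upTo α) suc (1ℚ * 1/ₙ α) ⟩
      ι (length (upTo α)) * (1ℚ * 1/ₙ α) ≡⟨ cong₂ (λ n c → ι n * c) (length-applyUpTo id α) (*-identityˡ (1/ₙ α)) ⟩
      ι α * 1/ₙ α                        ≡⟨ ι*1/ₙ α ⟩
      1ℚ                                 ∎
      where open ≡-Reasoning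

    mean-const : ∀ c → mean (λ _ → c) ≡ c
    mean-const c = begin
      mean (λ _ → c)         ≡⟨ ∑-cong uniformℚ (λ _ → *-identityʳ c) ⟨
      mean (λ _ → c * 1ℚ)    ≡⟨ ∑-* uniformℚ c (λ _ → 1ℚ) ⟩
      c * mean (λ _ → 1ℚ)    ≡⟨ cong (c *_) mean-1 ⟩
      c * 1ℚ                 ≡⟨ *-identityʳ c ⟩
      c                      ∎
      where open ≡-Reasoning

    mean-affine : ∀ c d f → mean (λ l → c + d * f l) ≡ c + d * mean f
    mean-affine c d f = trans (∑-+ uniformℚ (λ _ → c) (λ l → d * f l))
      (cong₂ _+_ (mean-const c) (∑-* uniformℚ d f))

    mean-window : ∀ {f} a k → (∀ l → 0ℚ ≤ f l) → a ℕ.+ k ℕ.≤ α → α ℕ.≤ 7 ℕ.* k →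
      (∀ i → a ℕ.≤ i → i ℕ.< a ℕ.+ k → f (suc i) ≡ 1ℚ) → 1/ₙ 7 ≤ mean f
    mean-window {f} a k 0≤f a+k≤α α≤7k h = ≤-trans (*-cancel (0<ι α) (begin
      1/ₙ 7 * ι α              ≤⟨ *-monoʳ (0≤1/ₙ 7) (ι-mono α≤7k) ⟩
      1/ₙ 7 * ι (7 ℕ.* k)      ≡⟨ cong (1/ₙ 7 *_) (ι-* 7 k) ⟩
      1/ₙ 7 * (ι 7 * ι k)      ≡⟨ *-assoc (1/ₙ 7) (ι 7) (ι k) ⟨
      1ℚ * ι k                 ≡⟨ cong (_* ι k) (ι*1/ₙ α) ⟨
      ι α * 1/ₙ α * ι k        ≡⟨ lem (ι α) (1/ₙ α) (ι k) ⟩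
      ι k * (1ℚ * 1/ₙ α) * ι α ∎))
      (∑-window α id a k 0≤1*1/α 0≤f a+k≤α h)
      where
      open ≤-Reasoning
      lem : ∀ a i k → a * i * k ≡ k * (1ℚ * i) * a
      lem = solve-∀ ℚ-ring

    module _ {E : Set} (p : ℚ) where

      -- p may be any rational: the terms of a Cauchy sequence whose limit is a
      -- probability need not lie in [0, 1].
      𝔼 : List E → (List (E × ℕ) → ℚ) → ℚ
      𝔼 []       f = f []
      𝔼 (e ∷ es) f = p * mean (λ l → 𝔼 es (λ I → f ((e , l) ∷ I))) + (1ℚ - p) * 𝔼 es f

      𝔼-+ : ∀ es f g → 𝔼 es (λ I → f I + g I) ≡ 𝔼 es f + 𝔼 es g
      𝔼-+ []       f g = refl
      𝔼-+ (e ∷ es) f g = trans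
        (cong₂ (λ x y → p * x + (1ℚ - p) * y)
          (trans (∑-cong uniformℚ λ l → 𝔼-+ es _ _) (∑-+ uniformℚ _ _)) (𝔼-+ es f g))
        (lem p _ _ (𝔼 es f) (𝔼 es g))
        where
        lem : ∀ p x y s t → p * (x + y) + (1ℚ - p) * (s + t) ≡
          (p * x + (1ℚ - p) * s) + (p * y + (1ℚ - p) * t)
        lem = solve-∀ ℚ-ring

      𝔼-const : ∀ es c → 𝔼 es (λ _ → c) ≡ c
      𝔼-const []       c = refl
      𝔼-const (e ∷ es) c = trans
        (cong₂ (λ x y → p * x + (1ℚ - p) * y)
          (trans (∑-cong uniformℚ λ l → 𝔼-const es c) (mean-const c)) (𝔼-const es c))
        (lem p c)
        where
        lem : ∀ p c → p * c + (1ℚ - p) * c ≡ c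
        lem = solve-∀ ℚ-ring

      𝔼-nonneg : 0ℚ ≤ p → p ≤ 1ℚ → ∀ es {f} → (∀ I → 0ℚ ≤ f I) → 0ℚ ≤ 𝔼 es f
      𝔼-nonneg 0≤p p≤1 []       0≤f = 0≤f []
      𝔼-nonneg 0≤p p≤1 (e ∷ es) 0≤f = 0≤-+
        (0≤-* 0≤p (mean-nonneg λ l → 𝔼-nonneg 0≤p p≤1 es λ I → 0≤f _))
        (0≤-* (≤⇒0≤- p≤1) (𝔼-nonneg 0≤p p≤1 es 0≤f))

-- The probability that no pair of edges is hit, as a multi-affine polynomial.

module Avoidance where

  open Rationals
  open Expectation
  open import Data.Rational.Base hiding (_⊔_; _⊓_)
  open import Data.Rational.Properties as ℚ hiding (_≟_)

  𝟙 : Bool → ℚ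
  𝟙 b = if b then 1ℚ else 0ℚ

  0≤𝟙 : ∀ b → 0ℚ ≤ 𝟙 b
  0≤𝟙 false = ≤-refl
  0≤𝟙 true  = 0≤1

  𝟙≤1 : ∀ b → 𝟙 b ≤ 1ℚ
  𝟙≤1 false = 0≤1
  𝟙≤1 true  = ≤-refl

  module _ {E : Set} (_≟_ : DecidableEquality E) where

    _[_≔_] : (E → ℚ) → E → ℚ → E → ℚ
    (x [ e ≔ t ]) e′ = if does (e′ ≟ e) then t else x e′

    [≔]-≡ : ∀ x e t → (x [ e ≔ t ]) e ≡ t
    [≔]-≡ x e t with e ≟ e
    ... | yes _  = refl
    ... | no e≢e = ⊥-elim (e≢e refl)

    [≔]-≢ : ∀ x {e e′} t → e ≢ e′ → (x [ e ≔ t ]) e′ ≡ x e′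
    [≔]-≢ x {e} {e′} t e≢e′ with e′ ≟ e
    ... | yes e′≡e = ⊥-elim (e≢e′ (sym e′≡e))
    ... | no _     = refl

    endpoints : List (E × E) → List E
    endpoints []             = []
    endpoints ((a , b) ∷ ps) = a ∷ b ∷ endpoints ps

    -- For 0/1-valued x, the indicator of the event that no pair in ps has both
    -- members of value 1.
    noPair : List (E × E) → (E → ℚ) → ℚ
    noPair []             x = 1ℚ
    noPair ((a , b) ∷ ps) x = (1ℚ - x a * x b) * noPair ps x

    noPair-cong : ∀ ps {x y} → (∀ e → x e ≡ y e) → noPair ps x ≡ noPair ps y
    noPair-cong []             x≗y = refl
    noPair-cong ((a , b) ∷ ps) x≗y =
      cong₂ _*_ (cong₂ (λ s t → 1ℚ - s * t) (x≗y a) (x≗y b)) (noPair-cong ps x≗y)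

    noPair-[≔] : ∀ ps x {e} t → All (e ≢_) (endpoints ps) →
      noPair ps (x [ e ≔ t ]) ≡ noPair ps x
    noPair-[≔] []             x t []                  = refl
    noPair-[≔] ((a , b) ∷ ps) x t (e≢a ∷ e≢b ∷ e∉ps) =
      cong₂ _*_ (cong₂ (λ s t → 1ℚ - s * t) ([≔]-≢ x t e≢a) ([≔]-≢ x t e≢b))
        (noPair-[≔] ps x t e∉ps)

    -- Because the endpoints are distinct, `e` occurs in at most one factor, and there only
    -- linearly; all other factors go into the coefficients.
    noPair-affine : ∀ ps → Unique (endpoints ps) → ∀ x e →
      ∃₂ λ c d → ∀ t → noPair ps (x [ e ≔ t ]) ≡ c + d * t
    noPair-affine []             _ x e = 1ℚ , 0ℚ , lem
      where
      lem : ∀ t → 1ℚ ≡ 1ℚ + 0ℚ * t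
      lem = solve-∀ ℚ-ring
    noPair-affine ((a , b) ∷ ps) ((a≢b ∷ a∉ps) ∷ b∉ps ∷ uniq) x e with e ≟ a | e ≟ b
    ... | yes refl | _ = noPair ps x , - (x b * noPair ps x) , λ t → trans
      (cong₂ _*_ (cong₂ (λ s t → 1ℚ - s * t) ([≔]-≡ x a t) ([≔]-≢ x t a≢b)) (noPair-[≔] ps x t a∉ps))
      (lem t (x b) (noPair ps x))
      where
      lem : ∀ t y P → (1ℚ - t * y) * P ≡ P + - (y * P) * t
      lem = solve-∀ ℚ-ring
    ... | no _ | yes refl = noPair ps x , - (x a * noPair ps x) , λ t → trans
      (cong₂ _*_ (cong₂ (λ s t → 1ℚ - s * t) ([≔]-≢ x t (λ b≡a → a≢b (sym b≡a))) ([≔]-≡ x b t)) (noPair-[≔] ps x t b∉ps))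
      (lem t (x a) (noPair ps x))
      where
      lem : ∀ t y P → (1ℚ - y * t) * P ≡ P + - (y * P) * t
      lem = solve-∀ ℚ-ring
    ... | no e≢a | no e≢b =
      let (c , d , affine) = noPair-affine ps uniq x e
          F = 1ℚ - x a * x b
      in F * c , F * d , λ t → trans
        (cong₂ _*_ (cong₂ (λ s t → 1ℚ - s * t) ([≔]-≢ x t e≢a) ([≔]-≢ x t e≢b)) (affine t))
        (lem F c d t)
      where
      lem : ∀ F c d t → F * (c + d * t) ≡ F * c + F * d * t
      lem = solve-∀ ℚ-ring

    noPair-bounds : ∀ {y} ps x → y ≤ 1ℚ →
      All (λ (a , b) → y ≤ x a * x b × x a * x b ≤ 1ℚ) ps →
      0ℚ ≤ noPair ps x × noPair ps x ≤ (1ℚ - y) ^ length ps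
    noPair-bounds []             x y≤1 []                       = 0≤1 , ≤-refl
    noPair-bounds ((a , b) ∷ ps) x y≤1 ((y≤xx , xx≤1) ∷ bounds) =
      let (0≤P , P≤) = noPair-bounds ps x y≤1 bounds
      in 0≤-* (≤⇒0≤- xx≤1) 0≤P
       , *-mono (≤⇒0≤- xx≤1) (^-nonneg (length ps) (≤⇒0≤- y≤1))
           (+-monoʳ-≤ 1ℚ (neg-antimono-≤ y≤xx)) P≤

    module _ (κ : E → ℕ → Bool) where

      -- An arbitrary starting assignment `x` lets an induction over the edges carry those whose
      -- labels are already known.
      reveal : (E → ℚ) → List (E × ℕ) → E → ℚ
      reveal x []            = x
      reveal x ((e , l) ∷ I) = reveal (x [ e ≔ 𝟙 (κ e l) ]) I

      reveal-source : ∀ x I e → reveal x I e ≡ x e ⊎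
        (∃ λ l → (e , l) ∈ I × reveal x I e ≡ 𝟙 (κ e l))
      reveal-source x []             e = inj₁ refl
      reveal-source x ((e′ , l) ∷ I) e with reveal-source (x [ e′ ≔ 𝟙 (κ e′ l) ]) I e
      ... | inj₂ (l′ , e∈I , eq) = inj₂ (l′ , there e∈I , eq)
      ... | inj₁ eq with e′ ≟ e
      ...   | yes refl = inj₂ (l , here refl , trans eq ([≔]-≡ x e (𝟙 (κ e l))))
      ...   | no e′≢e  = inj₁ (trans eq ([≔]-≢ x (𝟙 (κ e′ l)) e′≢e))

      labelIndicator : List (E × ℕ) → E → ℚ
      labelIndicator = reveal (λ _ → 0ℚ)

      labelIndicator-source : ∀ I e → labelIndicator I e ≡ 0ℚ ⊎
        (labelIndicator I e ≡ 1ℚ × ∃ λ l → (e , l) ∈ I × T (κ e l))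
      labelIndicator-source I e with reveal-source (λ _ → 0ℚ) I e
      ... | inj₁ eq = inj₁ eq
      ... | inj₂ (l , e∈I , eq) with κ e l in κel
      ...   | false = inj₁ eq
      ...   | true  = inj₂ (eq , l , e∈I , subst T (sym κel) tt)

      0≤1-xy : ∀ I a b → 0ℚ ≤ 1ℚ - labelIndicator I a * labelIndicator I b
      0≤1-xy I a b with labelIndicator-source I a | labelIndicator-source I b
      ... | inj₁ p       | inj₁ q       rewrite p | q = 0≤1
      ... | inj₁ p       | inj₂ (q , _) rewrite p | q = 0≤1
      ... | inj₂ (p , _) | inj₁ q       rewrite p | q = 0≤1
      ... | inj₂ (p , _) | inj₂ (q , _) rewrite p | q = ≤-refl

      noPair-nonneg : ∀ ps I → 0ℚ ≤ noPair ps (labelIndicator I)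
      noPair-nonneg []             I = 0≤1
      noPair-nonneg ((a , b) ∷ ps) I = 0≤-* (0≤1-xy I a b) (noPair-nonneg ps I)

      -- All values are 0 or 1. A pair with a zero member contributes the factor 1, so if every pair
      -- had one the product would be exactly 1.
      noPair<1⇒pair : ∀ ps I → noPair ps (labelIndicator I) < 1ℚ →
        ∃₂ λ a b → (a , b) ∈ ps ×
          (∃ λ l → (a , l) ∈ I × T (κ a l)) × (∃ λ l → (b , l) ∈ I × T (κ b l))
      noPair<1⇒pair []             I 1<1 = ⊥-elim (<-irrefl refl 1<1)
      noPair<1⇒pair ((a , b) ∷ ps) I <1
        with labelIndicator-source I a | labelIndicator-source I b
      ... | inj₂ (_ , at-a) | inj₂ (_ , at-b) = a , b , here refl , at-a , at-b
      ... | inj₁ a≡0 | _ =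
        let (a′ , b′ , ∈ps , r) = noPair<1⇒pair ps I (subst (_< 1ℚ)
              (trans (cong (λ z → (1ℚ - z * labelIndicator I b) * P) a≡0) (lem (labelIndicator I b) P)) <1)
        in a′ , b′ , there ∈ps , r
        where
        P = noPair ps (labelIndicator I)
        lem : ∀ y P → (1ℚ - 0ℚ * y) * P ≡ P
        lem = solve-∀ ℚ-ring
      ... | inj₂ _ | inj₁ b≡0 =
        let (a′ , b′ , ∈ps , r) = noPair<1⇒pair ps I (subst (_< 1ℚ)
              (trans (cong (λ z → (1ℚ - labelIndicator I a * z) * P) b≡0) (lem (labelIndicator I a) P)) <1)
        in a′ , b′ , there ∈ps , r
        where
        P = noPair ps (labelIndicator I)
        lem : ∀ y P → (1ℚ - y * 0ℚ) * P ≡ P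
        lem = solve-∀ ℚ-ring

      module _ (α : ℕ) .{{_ : ℕ.NonZero α}} (p : ℚ) where

        hitting : E → ℚ
        hitting e = p * mean α (λ l → 𝟙 (κ e l))

        -- The mean of `reveal x` when `x` vanishes on `es`: an absent edge counts as 0, a present
        -- one as the chance that its label is accepted.
        average : (E → ℚ) → List E → E → ℚ
        average x []       = x
        average x (e ∷ es) = average x es [ e ≔ hitting e ]

        average-∉ : ∀ x es {e} → All (e ≢_) es → average x es e ≡ x e
        average-∉ x []        []           = refl
        average-∉ x (e′ ∷ es) (e≢e′ ∷ e∉es) =
          trans ([≔]-≢ (average x es) _ (λ e′≡e → e≢e′ (sym e′≡e))) (average-∉ x es e∉es)

        average-[≔] : ∀ x es {e} t → All (e ≢_) es → ∀ e′ →
          average (x [ e ≔ t ]) es e′ ≡ (average x es [ e ≔ t ]) e′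
        average-[≔] x []         t _             e′ = refl
        average-[≔] x (e″ ∷ es) {e} t (e≢e″ ∷ e∉es) e′ with e′ ≟ e″
        ... | no _     = average-[≔] x es t e∉es e′
        ... | yes refl with e′ ≟ e
        ...   | yes e′≡e = ⊥-elim (e≢e″ (sym e′≡e))
        ...   | no _     = refl

        average-∈ : ∀ x es {e} → e ∈ es → average x es e ≡ hitting e
        average-∈ x (e′ ∷ es) {e} e∈ with e ≟ e′
        ... | yes refl = refl
        average-∈ x (e′ ∷ es) {e} (here e≡e′) | no e≢e′ = ⊥-elim (e≢e′ e≡e′)
        average-∈ x (e′ ∷ es) {e} (there e∈)  | no e≢e′ = average-∈ x es e∈

        -- noPair is affine in each coordinate separately, so each revealed edge
        -- may be replaced by its mean.
        𝔼-noPair : ∀ ps → Unique (endpoints ps) → ∀ es → Unique es →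
          ∀ x → All (λ e → x e ≡ 0ℚ) es →
          𝔼 α p es (λ I → noPair ps (reveal x I)) ≡ noPair ps (average x es)
        𝔼-noPair ps uniq []       _               x _             = refl
        𝔼-noPair ps uniq (e ∷ es) (e∉es ∷ uniq-es) x (xe≡0 ∷ x≡0) =
          let (c , d , affine) = noPair-affine ps uniq (average x es) e
              absent : noPair ps (average x es) ≡ c + d * 0ℚ
              absent = trans (noPair-cong ps λ e′ → unchanged e′) (affine 0ℚ)
          in begin
            p * mean α (λ l → 𝔼 α p es (λ I → noPair ps (reveal (x [ e ≔ 𝟙 (κ e l) ]) I)))
              + (1ℚ - p) * 𝔼 α p es (λ I → noPair ps (reveal x I))
              ≡⟨ cong₂ (λ s t → p * s + (1ℚ - p) * t)
                   (∑-cong (uniformℚ α) λ l → trans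
                     (𝔼-noPair ps uniq es uniq-es _ (stays-0 (𝟙 (κ e l)) e∉es x≡0))
                     (trans (noPair-cong ps (average-[≔] x es _ e∉es)) (affine _)))
                   (trans (𝔼-noPair ps uniq es uniq-es x x≡0) absent) ⟩
            p * mean α (λ l → c + d * 𝟙 (κ e l)) + (1ℚ - p) * (c + d * 0ℚ)
              ≡⟨ cong (λ s → p * s + (1ℚ - p) * (c + d * 0ℚ)) (mean-affine α c d _) ⟩
            p * (c + d * mean α (λ l → 𝟙 (κ e l))) + (1ℚ - p) * (c + d * 0ℚ)
              ≡⟨ lem p c d _ ⟩
            c + d * hitting e
              ≡⟨ affine (hitting e) ⟨
            noPair ps (average x es [ e ≔ hitting e ]) ∎
          where
          open ≡-Reasoning
          lem : ∀ p c d m → p * (c + d * m) + (1ℚ - p) * (c + d * 0ℚ) ≡ c + d * (p * m)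
          lem = solve-∀ ℚ-ring
          unchanged : ∀ e′ → average x es e′ ≡ (average x es [ e ≔ 0ℚ ]) e′
          unchanged e′ with e′ ≟ e
          ... | yes refl = trans (average-∉ x es e∉es) xe≡0
          ... | no _     = refl
          stays-0 : ∀ t {fs} → All (e ≢_) fs → All (λ f → x f ≡ 0ℚ) fs → All (λ f → (x [ e ≔ t ]) f ≡ 0ℚ) fs
          stays-0 t []            []           = []
          stays-0 t (e≢f ∷ e∉fs) (xf≡0 ∷ x≡0) = trans ([≔]-≢ x t e≢f) xf≡0 ∷ stays-0 t e∉fs x≡0

-- Journeys, decidability of temporal connectivity, and minimal spanning sublists.

module Journeys where

  open import Defs using (TemporalGraph; TimeEdge; Walk; stop; step; vertices; labels; Journey; TC; Needs)
  open import Data.Nat.Base using (ℕ; zero; suc; _+_; _*_; _≤_; _<_; z≤n; s≤s; _⊔_)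
  open import Data.Nat.Properties

  module _ {n : ℕ} (S : TemporalGraph n) where

    Link : Fin n → Fin n → ℕ → Set
    Link u w l = ((u , w) , l) ∈ S ⊎ ((w , u) , l) ∈ S

    -- Journeys without the path condition, with a lower bound on the first label. The bound makes
    -- them easy to concatenate and to search for; repeated vertices are removed afterwards.
    data From : ℕ → Fin n → Fin n → Set where
      stop : ∀ {t u} → From t u u
      step : ∀ {t u w v} l → t ≤ l → Link u w l → From (suc l) w v → From t u v

  module _ {n : ℕ} {S : TemporalGraph n} where

    weaken : ∀ {s t u v} → s ≤ t → From S t u v → From S s u v
    weaken s≤t stop                    = stop
    weaken s≤t (step l t≤l link rest) = step l (≤-trans s≤t t≤l) link rest

    fromLinked : ∀ {u v l} (w : Walk S u v) → Linked _<_ (l ∷ labels w) → From S (suc l) u v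
    fromLinked stop              _              = stop
    fromLinked (step l link w) (l₀<l ∷ linked) = step l l₀<l link (fromLinked w linked)

    fromJourney : ∀ {u v} → Journey S u v → From S 0 u v
    fromJourney j with Journey.walk j | Journey.increasing j
    ... | stop          | _      = stop
    ... | step l link w | linked = step l z≤n link (fromLinked w linked)

    Path : ℕ → Fin n → Fin n → Set
    Path t u v = Σ[ w ∈ Walk S u v ]
      Unique (vertices w) × Linked _<_ (labels w) × All (t ≤_) (labels w)

    tail-Linked : ∀ {l ls} → Linked _<_ (l ∷ ls) → Linked _<_ ls
    tail-Linked [-]          = []
    tail-Linked (_ ∷ linked) = linked

    suffix : ∀ {t u x v} (w : Walk S x v) → u ∈ vertices w → Unique (vertices w) →
      Linked _<_ (labels w) → All (t ≤_) (labels w) → Path t u v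
    suffix stop             (here refl) uniq linked t≤       = stop , uniq , linked , t≤
    suffix (step l link w) (here refl) uniq linked t≤       = step l link w , uniq , linked , t≤
    suffix (step l link w) (there u∈)  (_ ∷ uniq) linked (_ ∷ t≤) =
      suffix w u∈ uniq (tail-Linked linked) t≤

    linked-∷ : ∀ {l ls} → All (suc l ≤_) ls → Linked _<_ ls → Linked _<_ (l ∷ ls)
    linked-∷ []        _      = [-]
    linked-∷ (l< ∷ _) linked = l< ∷ linked

    -- If the start vertex is visited again, the part of the walk from that visit on replaces the
    -- whole: its labels still increase, and they exceed the label of the dropped first step.
    loopErase : ∀ {t u v} → From S t u v → Path t u v
    loopErase stop = stop , [] ∷ [] , [] , []
    loopErase {u = u} (step l t≤l link rest) with loopErase rest
    ... | w , uniq , linked , l< with any? (u Fin.≟_) (vertices w)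
    ...   | yes u∈ = suffix w u∈ uniq linked (All.map (≤-trans (m≤n⇒m≤1+n t≤l)) l<)
    ...   | no u∉  = step l link w , ¬Any⇒All¬ (vertices w) u∉ ∷ uniq
                   , linked-∷ l< linked , t≤l ∷ All.map (≤-trans (m≤n⇒m≤1+n t≤l)) l<

    toJourney : ∀ {u v} → From S 0 u v → Journey S u v
    toJourney f = let (w , uniq , linked , _) = loopErase f in
      record { walk = w ; path = uniq ; increasing = linked }

    -- The first step phrased as a property of one time-edge, so that its existence becomes a search
    -- through the list `S`.
    Next : ℕ → Fin n → Fin n → TimeEdge n → Set
    Next t u v ((a , b) , l) =
      t ≤ l × ((a ≡ u × From S (suc l) b v) ⊎ (b ≡ u × From S (suc l) a v))

    fromNext : ∀ {t u v} → (u ≡ v) ⊎ Any (Next t u v) S → From S t u v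
    fromNext (inj₁ refl) = stop
    fromNext (inj₂ any) with find any
    ... | (_ , l) , e∈ , t≤l , inj₁ (refl , rest) = step l t≤l (inj₁ e∈) rest
    ... | (_ , l) , e∈ , t≤l , inj₂ (refl , rest) = step l t≤l (inj₂ e∈) rest

    toNext : ∀ {t u v} → From S t u v → (u ≡ v) ⊎ Any (Next t u v) S
    toNext stop                         = inj₁ refl
    toNext (step l t≤l (inj₁ e∈) rest) = inj₂ (lose e∈ (t≤l , inj₁ (refl , rest)))
    toNext (step l t≤l (inj₂ e∈) rest) = inj₂ (lose e∈ (t≤l , inj₂ (refl , rest)))

    module _ {B : ℕ} (bound : ∀ {e l} → (e , l) ∈ S → l < B) where

      -- `k` is fuel: a step with label l ≥ t moves the threshold to l + 1, so B - t steps are the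
      -- most there can be. When `k` is 0 every label lies below the threshold and only the empty
      -- walk remains.
      from? : ∀ k t → B ≤ t + k → ∀ u v → Dec (From S t u v)
      next? : ∀ k t → B ≤ t + suc k → ∀ u v → Decidable (Next t u v)

      from? zero    t B≤t u v = map′ (λ { refl → stop }) stopped (u Fin.≟ v)
        where
        stopped : From S t u v → u ≡ v
        stopped stop = refl
        stopped (step l t≤l link _) = ⊥-elim (<⇒≱ ([ bound , bound ]′ link)
          (≤-trans (≤-trans B≤t (≤-reflexive (+-identityʳ t))) t≤l))
      from? (suc k) t B≤t+k u v = map′ fromNext toNext
        ((u Fin.≟ v) ⊎-dec any? (next? k t B≤t+k u v) S)

      next? k t B≤ u v ((a , b) , l) with t ≤? l
      ... | no t≰l  = no (t≰l ∘ proj₁)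
      ... | yes t≤l = map′ (t≤l ,_) proj₂
        (((a Fin.≟ u) ×-dec from? k (suc l) B≤′ b v) ⊎-dec
         ((b Fin.≟ u) ×-dec from? k (suc l) B≤′ a v))
        where
        B≤′ = ≤-trans B≤ (≤-trans (≤-reflexive (+-suc t k)) (s≤s (+-monoˡ-≤ k t≤l)))

  latest : ∀ {n} → TemporalGraph n → ℕ
  latest []            = 0
  latest ((_ , l) ∷ S) = suc l ⊔ latest S

  <latest : ∀ {n} (S : TemporalGraph n) {e l} → (e , l) ∈ S → l < latest S
  <latest ((_ , l) ∷ S) (here refl) = m≤m⊔n (suc l) (latest S)
  <latest ((_ , l) ∷ S) (there e∈)  = ≤-trans (<latest S e∈) (m≤n⊔m (suc l) (latest S))

  -- Needed to find the minimum in `Needs`: the search for the least size has to test each candidate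
  -- sublist.
  TC? : ∀ {n} → Decidable (TC {n})
  TC? S = Fin.all? λ u → Fin.all? λ v → ¬? (u Fin.≟ v) →-dec
    map′ toJourney fromJourney (from? {S = S} (<latest S) (latest S) 0 ≤-refl u v)

  module _ {A : Set} where

    sublist? : ∀ {P : List A → Set} → Decidable P → ∀ I → Dec (∃ λ S → S ⊆ I × P S)
    sublist? P? [] = map′ (λ p → [] , [] , p) (λ { ([] , [] , p) → p }) (P? [])
    sublist? {P} P? (x ∷ I) = map′ join split
      (sublist? P? I ⊎-dec sublist? (P? ∘ (x ∷_)) I)
      where
      join : (∃ λ S → S ⊆ I × P S) ⊎ (∃ λ S → S ⊆ I × P (x ∷ S)) → ∃ λ S → S ⊆ x ∷ I × P S
      join (inj₁ (S , S⊆I , p)) = S , x ∷ʳ S⊆I , p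
      join (inj₂ (S , S⊆I , p)) = x ∷ S , refl ∷ S⊆I , p
      split : (∃ λ S → S ⊆ x ∷ I × P S) → (∃ λ S → S ⊆ I × P S) ⊎ (∃ λ S → S ⊆ I × P (x ∷ S))
      split (S , _ ∷ʳ S⊆I , p)           = inj₁ (S , S⊆I , p)
      split (_ ∷ S , refl ∷ S⊆I , p)     = inj₂ (S , S⊆I , p)

    insert : ∀ {S I : List A} {x} → S ⊆ I → x ∈ I →
      ∃ λ S′ → S′ ⊆ I × x ∈ S′ × (∀ {y} → y ∈ S → y ∈ S′) × length S′ ≤ suc (length S)
    insert (y ∷ʳ S⊆I) (here refl) = y ∷ _ , refl ∷ S⊆I , here refl , there , ≤-refl
    insert (y ∷ʳ S⊆I) (there x∈I) =
      let (S′ , S′⊆I , x∈S′ , S⊆S′ , len) = insert S⊆I x∈I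
      in S′ , y ∷ʳ S′⊆I , x∈S′ , S⊆S′ , len
    insert (refl ∷ S⊆I) (here refl) = _ , refl ∷ S⊆I , here refl , id , n≤1+n _
    insert (_∷_ {x = y} refl S⊆I) (there x∈I) =
      let (S′ , S′⊆I , x∈S′ , S⊆S′ , len) = insert S⊆I x∈I
      in y ∷ S′ , refl ∷ S′⊆I , there x∈S′
       , (λ { (here refl) → here refl ; (there y∈S) → there (S⊆S′ y∈S) }) , s≤s len

    -- The time-edges gathered for different vertices come in arbitrary order and may coincide; this
    -- turns them into a genuine sublist of `I` without increasing their number.
    cover : ∀ {I : List A} J → All (_∈ I) J →
      ∃ λ S → S ⊆ I × (∀ {y} → y ∈ J → y ∈ S) × length S ≤ length J
    cover []      []           = [] , minimum _ , (λ ()) , z≤n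
    cover (x ∷ J) (x∈I ∷ J⊆I) =
      let (S  , S⊆I  , J⊆S , len)            = cover J J⊆I
          (S′ , S′⊆I , x∈S′ , S⊆S′ , len′) = insert S⊆I x∈I
      in S′ , S′⊆I
       , (λ { (here refl) → x∈S′ ; (there y∈J) → S⊆S′ (J⊆S y∈J) })
       , ≤-trans len′ (s≤s len)

  least : ∀ {Q : ℕ → Set} → Decidable Q → ∀ {n} → Q n →
    ∃ λ m → Q m × (∀ k → Q k → m ≤ k)
  least {Q} Q? {n} q with Q? 0
  ... | yes q₀ = 0 , q₀ , λ _ _ → z≤n
  least Q? {zero}  q | no ¬q₀ = ⊥-elim (¬q₀ q)
  least {Q} Q? {suc n} q | no ¬q₀ =
    let (m , qm , min) = least {Q ∘ suc} (Q? ∘ suc) q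
    in suc m , qm , λ { zero q₀ → ⊥-elim (¬q₀ q₀) ; (suc k) qk → s≤s (min k qk) }

  needs : ∀ {n} {I S : TemporalGraph n} → S ⊆ I → TC S → ∃ λ m → Needs I m × m ≤ length S
  needs {I = I} {S} S⊆I tc =
    let (m , (S′ , S′⊆I , tc′ , len) , min) = least
          (λ k → sublist? (λ S → TC? S ×-dec (length S ≟ k)) I) (S , S⊆I , tc , refl)
    in m , ((S′ , S′⊆I , tc′ , len) , λ R R⊆I tcR → min (length R) (R , R⊆I , tcR , refl))
     , min (length S) (S , S⊆I , tc , refl)

  allEndpoints : ∀ {n} → TemporalGraph n → List (Fin n)
  allEndpoints []                  = []
  allEndpoints (((a , b) , _) ∷ S) = a ∷ b ∷ allEndpoints S

  length-allEndpoints : ∀ {n} (S : TemporalGraph n) → length (allEndpoints S) ≡ length S * 2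
  length-allEndpoints []      = refl
  length-allEndpoints (_ ∷ S) = cong (λ k → suc (suc k)) (length-allEndpoints S)

  endpoint₁ : ∀ {n} {S : TemporalGraph n} {a b l} → ((a , b) , l) ∈ S → a ∈ allEndpoints S
  endpoint₁ (here refl) = here refl
  endpoint₁ (there e∈)  = there (there (endpoint₁ e∈))

  endpoint₂ : ∀ {n} {S : TemporalGraph n} {a b l} → ((a , b) , l) ∈ S → b ∈ allEndpoints S
  endpoint₂ (here refl) = there (here refl)
  endpoint₂ (there e∈)  = there (there (endpoint₂ e∈))

  TC⇒∈endpoints : ∀ {k} {S : TemporalGraph (suc (suc k))} → TC S → ∀ u → u ∈ allEndpoints S
  TC⇒∈endpoints {k} {S} tc u = departs (other u) (proj₂ (other′ u))
    where
    other′ : ∀ u → Σ[ v ∈ Fin (suc (suc k)) ] u ≢ v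
    other′ zero    = suc zero , λ ()
    other′ (suc _) = zero , λ ()
    other = proj₁ ∘ other′
    departs : ∀ v → u ≢ v → u ∈ allEndpoints S
    departs v u≢v with Journey.walk (tc u v u≢v)
    ... | stop          = ⊥-elim (u≢v refl)
    ... | step _ link _ = [ endpoint₁ , endpoint₂ ]′ link

  -- Pigeonhole: each vertex has a journey to some other vertex, hence a position in the list of
  -- endpoints, and the entry at that position recovers the vertex.
  TC⇒n≤2∣S∣ : ∀ {k} {S : TemporalGraph (suc (suc k))} → TC S → suc (suc k) ≤ length S * 2
  TC⇒n≤2∣S∣ {k} {S} tc = subst (suc (suc k) ≤_) (length-allEndpoints S)
    (Fin.injective⇒≤ {f = λ u → Any.index (TC⇒∈endpoints tc u)} inj)
    where
    open import Data.List.Base using (lookup)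
    inj : ∀ {u v} → Any.index (TC⇒∈endpoints {S = S} tc u) ≡ Any.index (TC⇒∈endpoints {S = S} tc v) → u ≡ v
    inj {u} {v} eq = trans (Any.lookup-index (TC⇒∈endpoints tc u))
      (trans (cong (lookup (allEndpoints S)) eq) (sym (Any.lookup-index (TC⇒∈endpoints tc v))))

  needs-≥ : ∀ {k m} {I : TemporalGraph (suc (suc k))} → Needs I m → suc (suc k) ≤ m * 2
  needs-≥ ((S , _ , tc , refl) , _) = TC⇒n≤2∣S∣ tc

-- The hub construction and the event that all detours through it exist.

module Hub where

  open Rationals
  open Expectation
  open Avoidance
  open Journeys
  open import Defs using (Edge; TimeEdge; TemporalGraph; possibleEdges; TC; Needs)
  open import Data.Rational.Base hiding (_⊔_; _⊓_)
  open import Data.Rational.Properties hiding (_≟_)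

  private variable
    A E : Set

  total : List A → (A → ℚ) → ℚ
  total []       f = 0ℚ
  total (a ∷ as) f = f a + total as f

  total-nonneg : ∀ (as : List A) {f} → (∀ a → 0ℚ ≤ f a) → 0ℚ ≤ total as f
  total-nonneg []       0≤f = ≤-refl
  total-nonneg (a ∷ as) 0≤f = 0≤-+ (0≤f a) (total-nonneg as 0≤f)

  term≤total : ∀ {as : List A} {f a} → (∀ a → 0ℚ ≤ f a) → a ∈ as → f a ≤ total as f
  term≤total {as = a ∷ as} {f} 0≤f (here refl) = ≤-by (total as f) (total-nonneg as 0≤f) refl
  term≤total {as = a ∷ as} {f} 0≤f (there a∈)  = ≤-trans (term≤total 0≤f a∈)
    (≤-by (f a) (0≤f a) (+-comm (f a) (total as f)))

  total-≤ : ∀ (as : List A) {f c} → (∀ a → f a ≤ c) → total as f ≤ ι (length as) * c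
  total-≤ []       {c = c} f≤c = ≤-reflexive (sym (*-zeroˡ c))
  total-≤ (a ∷ as) {f} {c} f≤c = ≤-trans (+-mono-≤ (f≤c a) (total-≤ as f≤c))
    (≤-reflexive (trans (lem c (ι (length as))) (cong (_* c) (sym (ι-suc (length as))))))
    where
    lem : ∀ c n → c + n * c ≡ (1ℚ + n) * c
    lem = solve-∀ ℚ-ring

  𝔼-total : ∀ α .{{_ : ℕ.NonZero α}} p (es : List E) (as : List A) (f : A → List (E × ℕ) → ℚ) →
    𝔼 α p es (λ I → total as (λ a → f a I)) ≡ total as (λ a → 𝔼 α p es (f a))
  𝔼-total α p es []       f = 𝔼-const α p es 0ℚ
  𝔼-total α p es (a ∷ as) f = trans (𝔼-+ α p es (f a) _)
    (cong (𝔼 α p es (f a) +_) (𝔼-total α p es as f))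

  opaque

    _<ᵇ1 : ℚ → Bool
    x <ᵇ1 = isYes (x <? 1ℚ)

    <ᵇ1⇒< : ∀ {x} → T (x <ᵇ1) → x < 1ℚ
    <ᵇ1⇒< {x} = toWitness {a? = x <? 1ℚ}

    0≤𝟙[<1]+x-1 : ∀ {x} → 0ℚ ≤ x → 0ℚ ≤ 𝟙 (x <ᵇ1) + x + - 1ℚ
    0≤𝟙[<1]+x-1 {x} = go (x <? 1ℚ)
      where
      go : (x<1? : Dec (x < 1ℚ)) → 0ℚ ≤ x → 0ℚ ≤ 𝟙 (isYes x<1?) + x + - 1ℚ
      go (yes _)  0≤x = subst (0ℚ ≤_) (lem x) 0≤x
        where
        lem : ∀ x → x ≡ 1ℚ + x + - 1ℚ
        lem = solve-∀ ℚ-ring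
      go (no x≮1) _   = subst (0ℚ ≤_) (lem x) (≤⇒0≤- (≮⇒≥ x≮1))
        where
        lem : ∀ x → x - 1ℚ ≡ 0ℚ + x + - 1ℚ
        lem = solve-∀ ℚ-ring

  -- Markov's inequality at threshold 1, obtained by taking the expectation of the pointwise
  -- inequality 𝟙[f < 1] + f - 1 ≥ 0.
  markov : ∀ α .{{_ : ℕ.NonZero α}} {p} (es : List E) → 0ℚ ≤ p → p ≤ 1ℚ →
    ∀ {f} → (∀ I → 0ℚ ≤ f I) →
    1ℚ - 𝔼 α p es f ≤ 𝔼 α p es (λ I → 𝟙 (f I <ᵇ1))
  markov α {p} es 0≤p p≤1 {f} 0≤f = 0≤-⇒≤ (subst (0ℚ ≤_) split (𝔼-nonneg α p 0≤p p≤1 es λ I → 0≤𝟙[<1]+x-1 (0≤f I)))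
    where
    g : _ → ℚ
    g I = 𝟙 (f I <ᵇ1)
    split : 𝔼 α p es (λ I → g I + f I + - 1ℚ) ≡ 𝔼 α p es g - (1ℚ - 𝔼 α p es f)
    split = trans (𝔼-+ α p es (λ I → g I + f I) (λ _ → - 1ℚ))
      (trans (cong₂ _+_ (𝔼-+ α p es g f) (𝔼-const α p es (- 1ℚ))) (lem (𝔼 α p es g) (𝔼 α p es f)))
      where
      lem : ∀ x y → x + y + - 1ℚ ≡ x - (1ℚ - y)
      lem = solve-∀ ℚ-ring

  module _ (_≟_ : DecidableEquality E) {f g : A → E}
    (f-inj : ∀ {x y} → f x ≡ f y → x ≡ y) (g-inj : ∀ {x y} → g x ≡ g y → x ≡ y)
    (f≢g : ∀ {x y} → f x ≢ g y) where

    zipPairs : List A → List (E × E)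
    zipPairs = map (λ x → f x , g x)

    f∉ : ∀ {x} xs → All (x ≢_) xs → All (f x ≢_) (endpoints _≟_ (zipPairs xs))
    f∉ []       []           = []
    f∉ (y ∷ xs) (x≢y ∷ x∉xs) = (x≢y ∘ f-inj) ∷ f≢g ∷ f∉ xs x∉xs

    g∉ : ∀ {x} xs → All (x ≢_) xs → All (g x ≢_) (endpoints _≟_ (zipPairs xs))
    g∉ []       []           = []
    g∉ (y ∷ xs) (x≢y ∷ x∉xs) = (f≢g ∘ sym) ∷ (x≢y ∘ g-inj) ∷ g∉ xs x∉xs

    endpoints-unique : ∀ {xs} → Unique xs → Unique (endpoints _≟_ (zipPairs xs))
    endpoints-unique []               = []
    endpoints-unique (x∉xs ∷ uniq-xs) =
      (f≢g ∷ f∉ _ x∉xs) ∷ g∉ _ x∉xs ∷ endpoints-unique uniq-xs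

  -- Labels start at 1, so these are gK + 1, …, gK + K.
  window : ℕ → ℕ → ℕ → Bool
  window K g zero    = false
  window K g (suc i) = (g ℕ.* K ℕ.≤ᵇ i) ∧ (i ℕ.<ᵇ g ℕ.* K ℕ.+ K)

  window-bounds : ∀ K g l → T (window K g l) → g ℕ.* K ℕ.< l × l ℕ.≤ suc g ℕ.* K
  window-bounds K g (suc i) h =
    let (lower , upper) = Equivalence.to T-∧ h
    in s≤s (ℕ.≤ᵇ⇒≤ (g ℕ.* K) i lower)
     , subst (i ℕ.<_) (ℕ.+-comm (g ℕ.* K) K) (ℕ.<ᵇ⇒< i _ upper)

  window-∈ : ∀ K g i → g ℕ.* K ℕ.≤ i → i ℕ.< g ℕ.* K ℕ.+ K → 𝟙 (window K g (suc i)) ≡ 1ℚ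
  window-∈ K g i lower upper = cong 𝟙 (Equivalence.to T-≡
    (Equivalence.from T-∧ (ℕ.≤⇒≤ᵇ lower , ℕ.<⇒<ᵇ upper)))

  module _ (k : ℕ) where

    private
      n : ℕ
      n = suc (suc k)

    infix 4 _≟ₑ_
    opaque
      _≟ₑ_ : DecidableEquality (Edge n)
      _≟ₑ_ = ≡-dec Fin._≟_ Fin._≟_

    -- The hub is the vertex zero; the other vertices are suc u.
    spoke : Fin (suc k) → Edge n
    spoke w = zero , suc w

    rim : Fin (suc k) → Fin (suc k) → Edge n
    rim u w = if Fin.toℕ u ℕ.<ᵇ Fin.toℕ w then (suc u , suc w) else (suc w , suc u)

    -- If the two edges list `u` on opposite sides, equating them would make `u` equal to its own
    -- neighbour; otherwise the other components agree.
    rim-injective : ∀ {u w w′} → u ≢ w → u ≢ w′ → rim u w ≡ rim u w′ → w ≡ w′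
    rim-injective {u} {w} {w′} u≢w u≢w′ eq with Fin.toℕ u ℕ.<ᵇ Fin.toℕ w | Fin.toℕ u ℕ.<ᵇ Fin.toℕ w′
    ... | true  | true  = Fin.suc-injective (,-injectiveʳ eq)
    ... | true  | false = ⊥-elim (u≢w′ (Fin.suc-injective (,-injectiveˡ eq)))
    ... | false | true  = ⊥-elim (u≢w′ (Fin.suc-injective (,-injectiveʳ eq)))
    ... | false | false = Fin.suc-injective (,-injectiveˡ eq)

    rim≢spoke : ∀ {u w w′} → rim u w ≢ spoke w′
    rim≢spoke {u} {w} eq with Fin.toℕ u ℕ.<ᵇ Fin.toℕ w
    rim≢spoke () | true 
    rim≢spoke () | false

    ∈-possibleEdges : ∀ {i j : Fin n} → i Fin.< j → (i , j) ∈ possibleEdges n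
    ∈-possibleEdges {i} {j} i<j = ∈-filter⁺ (λ (i , j) → i Fin.<? j)
      (∈-cartesianProduct⁺ (∈-allFin i) (∈-allFin j)) i<j

    possibleEdges-unique : Unique (possibleEdges n)
    possibleEdges-unique = Unique.filter⁺ (λ (i , j) → i Fin.<? j)
      (Unique.cartesianProduct⁺ (Unique.allFin⁺ n) (Unique.allFin⁺ n))

    spoke-∈ : ∀ w → spoke w ∈ possibleEdges n
    spoke-∈ w = ∈-possibleEdges (s≤s z≤n)

    rim-∈ : ∀ {u w} → u ≢ w → rim u w ∈ possibleEdges n
    rim-∈ {u} {w} u≢w with Fin.toℕ u ℕ.<ᵇ Fin.toℕ w in eq
    ... | true  = ∈-possibleEdges (s≤s (ℕ.<ᵇ⇒< _ _ (subst T (sym eq) tt)))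
    ... | false = ∈-possibleEdges (s≤s (ℕ.≤∧≢⇒< (ℕ.≮⇒≥ λ u<w → subst T eq (ℕ.<⇒<ᵇ u<w))
                    (u≢w ∘ sym ∘ Fin.toℕ-injective)))

    -- `punchIn u` runs through the `k` vertices other than `u` and the hub, that is, through the n
    -- - 2 candidates for the middle of a detour.
    pairs : Fin (suc k) → List (Edge n × Edge n)
    pairs u = map (λ j → rim u (punchIn u j) , spoke (punchIn u j)) (allFin k)

    length-pairs : ∀ u → length (pairs u) ≡ k
    length-pairs u = trans (length-map _ (allFin k)) (length-tabulate id)

    u≢punchIn : ∀ (u : Fin (suc k)) j → u ≢ punchIn u j
    u≢punchIn u j = Fin.punchInᵢ≢i u j ∘ sym

    pairs-unique : ∀ u → Unique (endpoints _≟ₑ_ (pairs u))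
    pairs-unique u = endpoints-unique _≟ₑ_
      (λ {i} {j} → Fin.punchIn-injective u i j ∘ rim-injective (u≢punchIn u i) (u≢punchIn u j))
      (λ {i} {j} → Fin.punchIn-injective u i j ∘ Fin.suc-injective ∘ ,-injectiveʳ)
      (λ {i} {j} → rim≢spoke {u} {punchIn u i})
      (Unique.allFin⁺ k)

    module _ (K : ℕ) where

      -- The smaller endpoint comes first and the hub is `zero`, so the first component alone tells
      -- spokes (window `s`) from rim edges (window `r`).
      κ : ℕ → ℕ → Edge n → ℕ → Bool
      κ r s (zero  , _) = window K s
      κ r s (suc _ , _) = window K r

      κ-rim : ∀ r s u w → κ r s (rim u w) ≡ window K r
      κ-rim r s u w with Fin.toℕ u ℕ.<ᵇ Fin.toℕ w
      ... | true  = refl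
      ... | false = refl

      failure : ℕ → ℕ → Fin (suc k) → TemporalGraph n → ℚ
      failure r s u I = noPair _≟ₑ_ (pairs u) (labelIndicator _≟ₑ_ (κ r s) I)

      -- Windows in order of travel: rim 0 and spoke 1 lead into the hub, spoke 2 and rim 3 lead out
      -- of it. On an instance every summand is 0 or 1, so a total below 1 means that no detour is
      -- missing.
      failures : TemporalGraph n → ℚ
      failures I = total (allFin (suc k)) (λ u → failure 0 1 u I + failure 3 2 u I)

      failure-nonneg : ∀ r s u I → 0ℚ ≤ failure r s u I
      failure-nonneg r s u I = noPair-nonneg _≟ₑ_ (κ r s) (pairs u) I

      both-nonneg : ∀ u I → 0ℚ ≤ failure 0 1 u I + failure 3 2 u I
      both-nonneg u I = 0≤-+ (failure-nonneg 0 1 u I) (failure-nonneg 3 2 u I)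

      failures-nonneg : ∀ I → 0ℚ ≤ failures I
      failures-nonneg I = total-nonneg (allFin (suc k)) λ u → both-nonneg u I

      good : TemporalGraph n → Bool
      good I = failures I <ᵇ1

      Detour : ℕ → ℕ → TemporalGraph n → Fin (suc k) → Set
      Detour r s I u = Σ[ w ∈ Fin (suc k) ] Σ[ l ∈ ℕ ] Σ[ m ∈ ℕ ]
        ((rim u w , l) ∈ I × (r ℕ.* K ℕ.< l × l ℕ.≤ suc r ℕ.* K)) ×
        ((spoke w , m) ∈ I × (s ℕ.* K ℕ.< m × m ℕ.≤ suc s ℕ.* K))

      detour : ∀ r s I u → failure r s u I < 1ℚ → Detour r s I u
      detour r s I u h =
        let (a , b , ab∈ , (l , a∈I , la) , (m , b∈I , mb)) =
              noPair<1⇒pair _≟ₑ_ (κ r s) (pairs u) I h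
        in go a b ab∈ l a∈I la m b∈I mb
        where
        go : ∀ a b → (a , b) ∈ pairs u → ∀ l → (a , l) ∈ I → T (κ r s a l) →
          ∀ m → (b , m) ∈ I → T (κ r s b m) → Detour r s I u
        go a b ab∈ l a∈I la m b∈I mb with ∈-map⁻ _ ab∈
        ... | j , _ , refl = punchIn u j , l , m
          , (a∈I , window-bounds K r l (subst (λ W → T (W l)) (κ-rim r s u (punchIn u j)) la))
          , (b∈I , window-bounds K s m mb)

      good⇒detours : ∀ I → T (good I) → ∀ u → Detour 0 1 I u × Detour 3 2 I u
      good⇒detours I h u = detour 0 1 I u (≤-<-trans (≤-trans
            (≤-by (failure 3 2 u I) (failure-nonneg 3 2 u I) refl) term≤) all<1)
        , detour 3 2 I u (≤-<-trans (≤-trans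
            (≤-by (failure 0 1 u I) (failure-nonneg 0 1 u I) (+-comm (failure 0 1 u I) _)) term≤) all<1)
        where
        all<1 : failures I < 1ℚ
        all<1 = <ᵇ1⇒< h
        term≤ : failure 0 1 u I + failure 3 2 u I ≤ failures I
        term≤ = term≤total {f = λ u → failure 0 1 u I + failure 3 2 u I} (λ u → both-nonneg u I) (∈-allFin u)

      usedBy : ∀ r s {I u} → Detour r s I u → List (TimeEdge n)
      usedBy r s {u = u} (w , l , m , _) = (rim u w , l) ∷ (spoke w , m) ∷ []

      rim-link : ∀ {S : TemporalGraph n} {u w l} → (rim u w , l) ∈ S → Link S (suc u) (suc w) l
      rim-link {u = u} {w} e∈ with Fin.toℕ u ℕ.<ᵇ Fin.toℕ w
      ... | true  = inj₁ e∈
      ... | false = inj₂ e∈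

      reverse : ∀ {S : TemporalGraph n} {u v l} → Link S u v l → Link S v u l
      reverse (inj₁ e∈) = inj₂ e∈
      reverse (inj₂ e∈) = inj₁ e∈

      module _ {I : TemporalGraph n} (detours : ∀ u → Detour 0 1 I u × Detour 3 2 I u) where

        needed : Fin (suc k) → List (TimeEdge n)
        needed u = usedBy 0 1 (proj₁ (detours u)) ++ usedBy 3 2 (proj₂ (detours u))

        needed-∈ : ∀ us → All (_∈ I) (concatMap needed us)
        needed-∈ []       = []
        needed-∈ (u ∷ us) with detours u
        ... | (_ , _ , _ , (a , _) , (b , _)) , (_ , _ , _ , (c , _) , (d , _)) =
          a ∷ b ∷ c ∷ d ∷ needed-∈ us

        length-needed : ∀ us → length (concatMap needed us) ≡ length us ℕ.* 4
        length-needed []       = refl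
        length-needed (u ∷ us) = cong (4 ℕ.+_) (length-needed us)

        ∈-needed : ∀ {u us e} → u ∈ us → e ∈ needed u → e ∈ concatMap needed us
        ∈-needed (here refl) e∈ = ∈-++⁺ˡ e∈
        ∈-needed {us = v ∷ us} (there u∈) e∈ = ∈-++⁺ʳ (needed v) (∈-needed u∈ e∈)

        module _ {S : TemporalGraph n} (⊇ : ∀ u {e} → e ∈ needed u → e ∈ S) where

          -- The threshold is where the halves of a journey meet: a label of window 1 is at most 2K,
          -- a label of window 2 is at least 2K + 1.
          fromHub : ∀ v → From S (suc (2 ℕ.* K)) zero v
          fromHub zero    = stop
          fromHub (suc v) with detours v | ⊇ v
          ... | _ , (w , l , m , (_ , l> , _) , (_ , m> , m≤)) | ⊇S =
            step m m> (inj₁ (⊇S (there (there (there (here refl))))))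
              (step l (ℕ.≤-<-trans m≤ l>) (reverse (rim-link {u = v} (⊇S (there (there (here refl)))))) stop)

          viaHub : ∀ u v → From S 0 u v
          viaHub zero    v = weaken z≤n (fromHub v)
          viaHub (suc u) v with detours u | ⊇ u
          ... | (w , l , m , (_ , l> , l≤) , (_ , m> , m≤)) , _ | ⊇S =
            step l z≤n (rim-link {u = u} (⊇S (here refl)))
              (step m (ℕ.≤-<-trans l≤ m>) (inj₂ (⊇S (there (here refl))))
                (weaken (s≤s m≤) (fromHub v)))

        sparseTC : ∃ λ S → S ⊆ I × TC S × length S ℕ.≤ suc k ℕ.* 4
        sparseTC =
          let (S , S⊆I , ⊇ , len) = cover (concatMap needed (allFin (suc k))) (needed-∈ (allFin (suc k)))
          in S , S⊆I
           , (λ u v _ → toJourney (viaHub (λ u e∈ → ⊇ (∈-needed (∈-allFin u) e∈)) u v))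
           , ℕ.≤-trans len (ℕ.≤-reflexive (trans (length-needed (allFin (suc k)))
               (cong (ℕ._* 4) (length-tabulate {n = suc k} id))))

      good⇒needs : ∀ I → T (good I) → ∃ λ m → Needs I m × m ℕ.≤ n ℕ.* 4 × n ℕ.≤ m ℕ.* 2
      good⇒needs I h =
        let (S , S⊆I , tc , len) = sparseTC (good⇒detours I h)
            (m , nd , m≤) = needs S⊆I tc
        in m , nd , ℕ.≤-trans m≤ (ℕ.≤-trans len (ℕ.*-monoˡ-≤ 4 (ℕ.n≤1+n (suc k)))) , needs-≥ nd

-- Lower bound on the success probability for rational p in [0, 1].

module Success where

  open Rationals
  open Expectation
  open Avoidance
  open Hub
  open import Defs using (Edge; TemporalGraph; possibleEdges)
  open import Data.Rational.Base hiding (_⊔_; _⊓_)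
  open import Data.Rational.Properties hiding (_≟_)

  module _ (α : ℕ) .{{_ : ℕ.NonZero α}} (4≤α : 4 ℕ.≤ α) where

    quarter : ℕ
    quarter = α ℕ./ 4

    -- As α ≥ 4 the quotient is at least 1, so the remainder, being at most 3, is at most three
    -- times the quotient. Equality holds at α = 7.
    α≤7*quarter : α ℕ.≤ 7 ℕ.* quarter
    α≤7*quarter = begin
      α                            ≡⟨ ℕ.m≡m%n+[m/n]*n α 4 ⟩
      α ℕ.% 4 ℕ.+ quarter ℕ.* 4    ≤⟨ ℕ.+-mono-≤ (ℕ.≤-trans (ℕ.<⇒≤pred (ℕ.m%n<n α 4)) (ℕ.*-monoʳ-≤ 3 (ℕ./-monoˡ-≤ 4 4≤α))) (ℕ.≤-reflexive (ℕ.*-comm quarter 4)) ⟩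
      3 ℕ.* quarter ℕ.+ 4 ℕ.* quarter ≡⟨ ℕ.*-distribʳ-+ quarter 3 4 ⟨
      7 ℕ.* quarter                ∎
      where open ℕ.≤-Reasoning

    window≤α : ∀ {g} → g ℕ.≤ 3 → g ℕ.* quarter ℕ.+ quarter ℕ.≤ α
    window≤α {g} g≤3 = begin
      g ℕ.* quarter ℕ.+ quarter ≡⟨ ℕ.+-comm (g ℕ.* quarter) quarter ⟩
      suc g ℕ.* quarter         ≤⟨ ℕ.*-monoˡ-≤ quarter (s≤s g≤3) ⟩
      4 ℕ.* quarter             ≡⟨ ℕ.*-comm 4 quarter ⟩
      quarter ℕ.* 4             ≤⟨ ℕ.m/n*n≤m α 4 ⟩
      α                         ∎
      where open ℕ.≤-Reasoning

    hitRate : ℕ → ℚ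
    hitRate g = mean α (λ l → 𝟙 (window quarter g l))

    1/7≤hitRate : ∀ {g} → g ℕ.≤ 3 → 1/ₙ 7 ≤ hitRate g
    1/7≤hitRate {g} g≤3 = mean-window α (g ℕ.* quarter) quarter (λ l → 0≤𝟙 (window quarter g l))
      (window≤α g≤3) α≤7*quarter (window-∈ quarter g)

    hitRate≤1 : ∀ g → hitRate g ≤ 1ℚ
    hitRate≤1 g = 0≤-⇒≤ (subst (0ℚ ≤_) eq (mean-nonneg α nonneg))
      where
      nonneg : ∀ l → 0ℚ ≤ 1ℚ + - 1ℚ * 𝟙 (window quarter g l)
      nonneg l = subst (0ℚ ≤_) (lem (𝟙 (window quarter g l))) (≤⇒0≤- (𝟙≤1 (window quarter g l)))
        where
        lem : ∀ x → 1ℚ - x ≡ 1ℚ + - 1ℚ * x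
        lem = solve-∀ ℚ-ring
      eq : mean α (λ l → 1ℚ + - 1ℚ * 𝟙 (window quarter g l)) ≡ 1ℚ - hitRate g
      eq = trans (mean-affine α 1ℚ (- 1ℚ) _) (lem (hitRate g))
        where
        lem : ∀ x → 1ℚ + - 1ℚ * x ≡ 1ℚ - x
        lem = solve-∀ ℚ-ring

    module _ (k : ℕ) {p : ℚ} (0≤p : 0ℚ ≤ p) (p≤1 : p ≤ 1ℚ) where

      es : List (Edge (suc (suc k)))
      es = possibleEdges (suc (suc k))

      q : ℚ
      q = p * 1/ₙ 7

      0≤q : 0ℚ ≤ q
      0≤q = 0≤-* 0≤p (0≤1/ₙ 7)

      q≤1 : q ≤ 1ℚ
      q≤1 = *-mono 0≤p 0≤1 p≤1 (≤-trans (1/7≤hitRate z≤n) (hitRate≤1 0))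

      hit : ℕ → ℕ → Edge (suc (suc k)) → ℚ
      hit r s = hitting (_≟ₑ_ k) (κ k quarter r s) α p

      hit-bounds : ∀ {r s} → r ℕ.≤ 3 → s ℕ.≤ 3 → ∀ e → q ≤ hit r s e × hit r s e ≤ 1ℚ
      hit-bounds {s = s} r≤3 s≤3 (zero  , _) =
        *-monoʳ 0≤p (1/7≤hitRate s≤3) , *-mono 0≤p 0≤1 p≤1 (hitRate≤1 s)
      hit-bounds {r = r} r≤3 s≤3 (suc _ , _) =
        *-monoʳ 0≤p (1/7≤hitRate r≤3) , *-mono 0≤p 0≤1 p≤1 (hitRate≤1 r)

      Q : ℚ
      Q = (1ℚ - q * q) ^ k

      q²≤1 : q * q ≤ 1ℚ
      q²≤1 = *-mono 0≤q 0≤1 q≤1 q≤1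

      -- By `𝔼-noPair` the expectation is the product over the `k` candidates of one minus the
      -- product of two means, and each mean is at least `q`.
      𝔼-failure : ∀ {r s} → r ℕ.≤ 3 → s ℕ.≤ 3 → ∀ u →
        𝔼 α p es (failure k quarter r s u) ≤ Q
      𝔼-failure {r} {s} r≤3 s≤3 u = ≤-trans
        (≤-reflexive (𝔼-noPair (_≟ₑ_ k) (κ k quarter r s) α p (pairs k u) (pairs-unique k u)
          es (possibleEdges-unique k) (λ _ → 0ℚ) (All.universal (λ _ → refl) es)))
        (subst (λ j → noPair (_≟ₑ_ k) (pairs k u) x ≤ (1ℚ - q * q) ^ j) (length-pairs k u)
          (proj₂ (noPair-bounds (_≟ₑ_ k) (pairs k u) x q²≤1
            (All.map⁺ (All.universal (λ j → bounds (rim-∈ k (u≢punchIn k u j)) (spoke-∈ k _)) (allFin k))))))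
        where
        x : Edge (suc (suc k)) → ℚ
        x = average (_≟ₑ_ k) (κ k quarter r s) α p (λ _ → 0ℚ) es
        x-bounds : ∀ {e} → e ∈ es → q ≤ x e × x e ≤ 1ℚ
        x-bounds {e} e∈ = subst (λ z → q ≤ z × z ≤ 1ℚ)
          (sym (average-∈ (_≟ₑ_ k) (κ k quarter r s) α p (λ _ → 0ℚ) es e∈)) (hit-bounds r≤3 s≤3 e)
        bounds : ∀ {a b} → a ∈ es → b ∈ es → q * q ≤ x a * x b × x a * x b ≤ 1ℚ
        bounds a∈ b∈ =
          let (q≤a , a≤1) = x-bounds a∈
              (q≤b , b≤1) = x-bounds b∈
          in *-mono 0≤q (≤-trans 0≤q q≤b) q≤a q≤b , *-mono (≤-trans 0≤q q≤a) 0≤1 a≤1 b≤1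

      -- Union bound over the vertices other than the hub. The two directions of travel are the
      -- source of the factor 2 in the failure probability.
      𝔼-failures : 𝔼 α p es (failures k quarter) ≤ ι (suc k) * (Q + Q)
      𝔼-failures = begin
        𝔼 α p es (failures k quarter)
          ≡⟨ 𝔼-total α p es (allFin (suc k)) (λ u I → failure k quarter 0 1 u I + failure k quarter 3 2 u I) ⟩
        total (allFin (suc k)) (λ u → 𝔼 α p es (λ I → failure k quarter 0 1 u I + failure k quarter 3 2 u I))
          ≤⟨ total-≤ (allFin (suc k)) each ⟩
        ι (length (allFin (suc k))) * (Q + Q)
          ≡⟨ cong (λ j → ι j * (Q + Q)) (length-tabulate {n = suc k} id) ⟩
        ι (suc k) * (Q + Q) ∎
        where
        open ≤-Reasoning
        each : ∀ u → 𝔼 α p es (λ I → failure k quarter 0 1 u I + failure k quarter 3 2 u I) ≤ Q + Q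
        each u = ≤-trans (≤-reflexive (𝔼-+ α p es (failure k quarter 0 1 u) (failure k quarter 3 2 u)))
          (+-mono-≤ (𝔼-failure z≤n (s≤s z≤n) u) (𝔼-failure ℕ.≤-refl (s≤s (s≤s z≤n)) u))

      good-likely : 320 ℕ.≤ suc (suc k) → 1ℚ ≤ ι (3 ℕ.* suc (suc k)) * q ^ 7 →
        1ℚ - ι 2 * 1/ₙ (suc (suc k)) ≤ 𝔼 α p es (λ I → 𝟙 (good k quarter I))
      good-likely 320≤n 1≤3nq⁷ = ≤-trans (+-monoʳ-≤ 1ℚ (neg-antimono-≤ 𝔼≤2/n))
        (markov α es 0≤p p≤1 (failures-nonneg k quarter))
        where
        n : ℕ
        n = suc (suc k)
        -- The hypothesis squared: a detour needs two hits, so the success rate of a candidate is y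
        -- = q².
        1≤9n²y⁷ : 1ℚ ≤ ι (9 ℕ.* n ℕ.^ 2) * (q * q) ^ 7
        1≤9n²y⁷ = ≤-trans (*-mono 0≤1 (≤-trans 0≤1 1≤3nq⁷) 1≤3nq⁷ 1≤3nq⁷) (≤-reflexive (begin
          ι (3 ℕ.* n) * q ^ 7 * (ι (3 ℕ.* n) * q ^ 7) ≡⟨ lem (ι (3 ℕ.* n)) (q ^ 7) ⟩
          ι (3 ℕ.* n) * ι (3 ℕ.* n) * (q ^ 7 * q ^ 7) ≡⟨ cong₂ _*_ (sym (ι-* (3 ℕ.* n) (3 ℕ.* n))) (sym (^-distrib-* q q 7)) ⟩
          ι (3 ℕ.* n ℕ.* (3 ℕ.* n)) * (q * q) ^ 7     ≡⟨ cong (λ z → ι z * (q * q) ^ 7) (trans (ℕ.[m*n]*[o*p]≡[m*o]*[n*p] 3 n 3 n) (cong (λ z → 9 ℕ.* (n ℕ.* z)) (sym (ℕ.*-identityʳ n)))) ⟩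
          ι (9 ℕ.* n ℕ.^ 2) * (q * q) ^ 7             ∎))
          where
          open ≡-Reasoning
          lem : ∀ a b → a * b * (a * b) ≡ a * a * (b * b)
          lem = solve-∀ ℚ-ring
        nQ≤1/n : ι n * Q ≤ 1/ₙ n
        nQ≤1/n = begin
          ι n * Q                      ≡⟨ *-identityˡ (ι n * Q) ⟨
          1ℚ * (ι n * Q)               ≡⟨ cong (_* (ι n * Q)) (ι*1/ₙ n) ⟨
          ι n * 1/ₙ n * (ι n * Q)      ≡⟨ lem (ι n) (1/ₙ n) Q ⟩
          1/ₙ n * (ι n * (ι n * 1ℚ) * Q) ≡⟨ cong (λ z → 1/ₙ n * (z * Q)) (ι-^ n 2) ⟨
          1/ₙ n * (ι (n ℕ.^ 2) * Q)    ≤⟨ *-monoʳ (0≤1/ₙ n) (tail-≤ k 320≤n (0≤-* 0≤q 0≤q) q²≤1 1≤9n²y⁷) ⟩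
          1/ₙ n * 1ℚ                   ≡⟨ *-identityʳ (1/ₙ n) ⟩
          1/ₙ n                        ∎
          where
          open ≤-Reasoning
          lem : ∀ n i Q → n * i * (n * Q) ≡ i * (n * (n * 1ℚ) * Q)
          lem = solve-∀ ℚ-ring
        𝔼≤2/n : 𝔼 α p es (failures k quarter) ≤ ι 2 * 1/ₙ n
        𝔼≤2/n = begin
          𝔼 α p es (failures k quarter) ≤⟨ 𝔼-failures ⟩
          ι (suc k) * (Q + Q)           ≤⟨ *-monoˡ (0≤-+ 0≤Q 0≤Q) (ι-mono (ℕ.n≤1+n (suc k))) ⟩
          ι n * (Q + Q)                 ≡⟨ *-distribˡ-+ (ι n) Q Q ⟩
          ι n * Q + ι n * Q             ≤⟨ +-mono-≤ nQ≤1/n nQ≤1/n ⟩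
          1/ₙ n + 1/ₙ n                 ≡⟨ lem (1/ₙ n) ⟩
          (1ℚ + 1ℚ) * 1/ₙ n             ∎
          where
          open ≤-Reasoning
          0≤Q : 0ℚ ≤ Q
          0≤Q = ^-nonneg k (≤⇒0≤- q²≤1)
          lem : ∀ x → x + x ≡ (1ℚ + 1ℚ) * x
          lem = solve-∀ ℚ-ring

-- Entries of the real probability as rational expectations, and continuity in p.

module Sampling where

  open Rationals
  open Expectation
  open Avoidance using (𝟙)
  open R using (ℝ; mkℝ; seq; cauchy; Cauchy; _≈_; Dist; ℙ; _>>=_; return; keepEach; uniform;
                labelUniformly; labelledG; possibleEdges; Edge; Graph; TemporalGraph)
  open import Data.Rational.Base hiding (_⊔_; _⊓_)
  open import Data.Rational.Properties hiding (_≟_)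

  private variable
    A B : Set

  filterᵇ-∷ : ∀ (P : A → Bool) x xs →
    filterᵇ P (x ∷ xs) ≡ (if P x then x ∷ filterᵇ P xs else filterᵇ P xs)
  filterᵇ-∷ P x xs with P x
  ... | true  = refl
  ... | false = refl

  module _ (i : ℕ) where

    weigh : Dist A → List (A × ℚ)
    weigh = map (map₂ λ v → seq v i)

    ∑-weigh : Dist A → (A → ℚ) → ℚ
    ∑-weigh d = ∑ (weigh d)

    sumℝ : Dist A → ℝ
    sumℝ d = foldr R._+_ R.0ℝ (map proj₂ d)

    seq-sum-if : ∀ b (a : A) v d →
      seq (sumℝ (if b then (a , v) ∷ d else d)) i ≡ seq v i * 𝟙 b + seq (sumℝ d) i
    seq-sum-if true  a v d = cong (_+ seq (sumℝ d) i) (sym (*-identityʳ (seq v i)))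
    seq-sum-if false a v d = lem (seq v i) (seq (sumℝ d) i)
      where
      lem : ∀ v s → s ≡ v * 0ℚ + s
      lem = solve-∀ ℚ-ring

    seq-ℙ : ∀ (d : Dist A) D → seq (ℙ d D) i ≡ ∑-weigh d (𝟙 ∘ D)
    seq-ℙ []            D = refl
    seq-ℙ ((a , v) ∷ d) D = trans
      (cong (λ z → seq (sumℝ z) i) (filterᵇ-∷ (λ (a , _) → D a) (a , v) d))
      (trans (seq-sum-if (D a) a v (filterᵇ (λ (a , _) → D a) d))
      (cong (seq v i * 𝟙 (D a) +_) (seq-ℙ d D)))

    ∑-scale : ∀ (d : Dist A) v f →
      ∑-weigh (map (λ (b , w) → b , v R.* w) d) f ≡ seq v i * ∑-weigh d f
    ∑-scale []            v f = sym (*-zeroʳ (seq v i))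
    ∑-scale ((b , w) ∷ d) v f = trans
      (cong (seq v i * seq w i * f b +_) (∑-scale d v f))
      (lem (seq v i) (seq w i) (f b) _)
      where
      lem : ∀ v w x s → v * w * x + v * s ≡ v * (w * x + s)
      lem = solve-∀ ℚ-ring

    ∑->>= : ∀ (d : Dist A) (k : A → Dist B) f →
      ∑-weigh (d >>= k) f ≡ ∑-weigh d (λ a → ∑-weigh (k a) f)
    ∑->>= []            k f = refl
    ∑->>= ((a , v) ∷ d) k f = begin
      ∑ (weigh (scaled ++ (d >>= k))) f           ≡⟨ cong (λ z → ∑ z f) (map-++ _ scaled (d >>= k)) ⟩
      ∑ (weigh scaled ++ weigh (d >>= k)) f       ≡⟨ ∑-++ (weigh scaled) (weigh (d >>= k)) f ⟩
      ∑-weigh scaled f + ∑-weigh (d >>= k) f      ≡⟨ cong₂ _+_ (∑-scale (k a) v f) (∑->>= d k f) ⟩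
      seq v i * ∑-weigh (k a) f + ∑-weigh d (λ a → ∑-weigh (k a) f) ∎
      where
      open ≡-Reasoning
      scaled = map (λ (b , w) → b , v R.* w) (k a)

    ∑-return : ∀ (a : A) f → ∑-weigh (return a) f ≡ f a
    ∑-return a f = lem (f a)
      where
      lem : ∀ x → 1ℚ * x + 0ℚ ≡ x
      lem = solve-∀ ℚ-ring

    ∑-bernoulli : ∀ p g →
      ∑-weigh (R.bernoulli p) g ≡ seq p i * g true + (1ℚ - seq p i) * g false
    ∑-bernoulli p g = cong (seq p i * g true +_) (+-identityʳ ((1ℚ - seq p i) * g false))

    ∑-keepEach : ∀ p (e : A) es f → ∑-weigh (keepEach p (e ∷ es)) f ≡
      seq p i * ∑-weigh (keepEach p es) (f ∘ (e ∷_)) + (1ℚ - seq p i) * ∑-weigh (keepEach p es) f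
    ∑-keepEach {A} p e es f = begin
      ∑-weigh (keepEach p (e ∷ es)) f
        ≡⟨ ∑->>= (R.bernoulli p) rest f ⟩
      ∑-weigh (R.bernoulli p) (λ present → ∑-weigh (rest present) f)
        ≡⟨ ∑-bernoulli p (λ present → ∑-weigh (rest present) f) ⟩
      seq p i * ∑-weigh (rest true) f + (1ℚ - seq p i) * ∑-weigh (rest false) f
        ≡⟨ cong₂ (λ x y → seq p i * x + (1ℚ - seq p i) * y) (inner true) (inner false) ⟩
      seq p i * ∑-weigh (keepEach p es) (f ∘ (e ∷_)) + (1ℚ - seq p i) * ∑-weigh (keepEach p es) f ∎
      where
      open ≡-Reasoning
      keep : Bool → List A → List A
      keep present kept = if present then e ∷ kept else kept
      rest : Bool → Dist (List A)
      rest present = keepEach p es >>= λ kept → return (keep present kept)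
      inner : ∀ present → ∑-weigh (rest present) f ≡ ∑-weigh (keepEach p es) (f ∘ keep present)
      inner present = trans (∑->>= (keepEach p es) (λ kept → return (keep present kept)) f)
        (∑-cong (weigh (keepEach p es)) λ kept → ∑-return (keep present kept) f)

    module _ (α : ℕ) .{{nz : ℕ.NonZero α}} {n : ℕ} where

      labels : Dist ℕ
      labels = uniform α {{nz}}

      weigh-uniform : weigh labels ≡ uniformℚ α
      weigh-uniform = sym (map-∘ (upTo α))

      ∑-label : ∀ e (g : Graph n) f → ∑-weigh (labelUniformly α (e ∷ g)) f ≡
        mean α (λ l → ∑-weigh (labelUniformly α g) (λ I → f ((e , l) ∷ I)))
      ∑-label e g f = begin
        ∑-weigh (labelUniformly α (e ∷ g)) f
          ≡⟨ ∑->>= labels rest f ⟩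
        ∑-weigh labels (λ l → ∑-weigh (rest l) f)
          ≡⟨ cong (λ z → ∑ z (λ l → ∑-weigh (rest l) f)) weigh-uniform ⟩
        mean α (λ l → ∑-weigh (rest l) f)
          ≡⟨ ∑-cong (uniformℚ α) inner ⟩
        mean α (λ l → ∑-weigh (labelUniformly α g) (λ I → f ((e , l) ∷ I))) ∎
        where
        open ≡-Reasoning
        rest : ℕ → Dist (TemporalGraph n)
        rest l = labelUniformly α g >>= λ others → return ((e , l) ∷ others)
        inner : ∀ l → ∑-weigh (rest l) f ≡ ∑-weigh (labelUniformly α g) (λ I → f ((e , l) ∷ I))
        inner l = trans (∑->>= (labelUniformly α g) (λ others → return ((e , l) ∷ others)) f)
          (∑-cong (weigh (labelUniformly α g)) λ others → ∑-return ((e , l) ∷ others) f)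

      -- The model draws the whole graph before any label, whereas `𝔼` labels each edge as soon as
      -- it is kept. Exchanging the sum over graphs with the sum over labels reconciles the two.
      ∑-labelled : ∀ p (es : Graph n) f →
        ∑-weigh (keepEach p es) (λ g → ∑-weigh (labelUniformly α g) f) ≡ 𝔼 α (seq p i) es f
      ∑-labelled p []       f = trans
        (∑-return {A = Graph n} [] (λ g → ∑-weigh (labelUniformly α g) f))
        (∑-return {A = TemporalGraph n} [] f)
      ∑-labelled p (e ∷ es) f = begin
        ∑-weigh (keepEach p (e ∷ es)) labelled
          ≡⟨ ∑-keepEach p e es labelled ⟩
        seq p i * ∑-weigh (keepEach p es) (labelled ∘ (e ∷_)) + (1ℚ - seq p i) * ∑-weigh (keepEach p es) labelled
          ≡⟨ cong₂ (λ x y → seq p i * x + (1ℚ - seq p i) * y) present (∑-labelled p es f) ⟩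
        𝔼 α (seq p i) (e ∷ es) f ∎
        where
        open ≡-Reasoning
        labelled : Graph n → ℚ
        labelled g = ∑-weigh (labelUniformly α g) f
        with-label : Graph n → ℕ → ℚ
        with-label g l = ∑-weigh (labelUniformly α g) (λ I → f ((e , l) ∷ I))
        present : ∑-weigh (keepEach p es) (labelled ∘ (e ∷_)) ≡
          mean α (λ l → 𝔼 α (seq p i) es (λ I → f ((e , l) ∷ I)))
        present = begin
          ∑-weigh (keepEach p es) (labelled ∘ (e ∷_))
            ≡⟨ ∑-cong (weigh (keepEach p es)) (λ g → ∑-label e g f) ⟩
          ∑-weigh (keepEach p es) (λ g → mean α (with-label g))
            ≡⟨ ∑-swap (weigh (keepEach p es)) (uniformℚ α) with-label ⟩
          mean α (λ l → ∑-weigh (keepEach p es) (λ g → with-label g l))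
            ≡⟨ ∑-cong (uniformℚ α) (λ l → ∑-labelled p es (λ I → f ((e , l) ∷ I))) ⟩
          mean α (λ l → 𝔼 α (seq p i) es (λ I → f ((e , l) ∷ I))) ∎

      -- Real arithmetic acts entry by entry, so the entries of the probability are one rational
      -- polynomial evaluated at the entries of `p`.
      seq-ℙ-labelledG : ∀ p D →
        seq (ℙ (labelledG n p α) D) i ≡ 𝔼 α (seq p i) (possibleEdges n) (𝟙 ∘ D)
      seq-ℙ-labelledG p D = begin
        seq (ℙ (labelledG n p α) D) i
          ≡⟨ seq-ℙ (labelledG n p α) D ⟩
        ∑-weigh (labelledG n p α) (𝟙 ∘ D)
          ≡⟨ ∑->>= (keepEach p (possibleEdges n)) (labelUniformly α) (𝟙 ∘ D) ⟩
        ∑-weigh (keepEach p (possibleEdges n)) (λ g → ∑-weigh (labelUniformly α g) (𝟙 ∘ D))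
          ≡⟨ ∑-labelled p (possibleEdges n) (𝟙 ∘ D) ⟩
        𝔼 α (seq p i) (possibleEdges n) (𝟙 ∘ D) ∎
        where open ≡-Reasoning

  Eventually : (ℕ → Set) → Set
  Eventually P = ∃ λ N → ∀ i → N ℕ.≤ i → P i

  eventually-map : ∀ {P Q : ℕ → Set} → (∀ {i} → P i → Q i) → Eventually P → Eventually Q
  eventually-map f (N , h) = N , λ i N≤i → f (h i N≤i)

  infixr 2 _⊗_
  _⊗_ : ∀ {P Q : ℕ → Set} → Eventually P → Eventually Q → Eventually (λ i → P i × Q i)
  (M , p) ⊗ (N , q) = M ℕ.⊔ N , λ i i≥ → p i (ℕ.m⊔n≤o⇒m≤o M N i≥) , q i (ℕ.m⊔n≤o⇒n≤o M N i≥)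

  ∣-∣-triangle : ∀ a b c → ∣ a - c ∣ ≤ ∣ a - b ∣ + ∣ b - c ∣
  ∣-∣-triangle a b c = subst (λ z → ∣ z ∣ ≤ ∣ a - b ∣ + ∣ b - c ∣) (lem a b c) (∣p+q∣≤∣p∣+∣q∣ (a - b) (b - c))
    where
    lem : ∀ a b c → (a - b) + (b - c) ≡ a - c
    lem = solve-∀ ℚ-ring

  ∣-∣-sym : ∀ a b → ∣ a - b ∣ ≡ ∣ b - a ∣
  ∣-∣-sym a b = trans (sym (∣-p∣≡∣p∣ (a - b))) (cong ∣_∣ (lem a b))
    where
    lem : ∀ a b → - (a - b) ≡ b - a
    lem = solve-∀ ℚ-ring

  1/₃-sum : ∀ ε → ε * 1/ₙ 3 + ε * 1/ₙ 3 + ε * 1/ₙ 3 ≡ ε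
  1/₃-sum ε = trans (lem ε (1/ₙ 3)) (*-identityʳ ε)
    where
    lem : ∀ ε t → ε * t + ε * t + ε * t ≡ ε * (t + t + t)
    lem = solve-∀ ℚ-ring

  0<1/₃ : ∀ {ε} → 0ℚ < ε → 0ℚ < ε * 1/ₙ 3
  0<1/₃ 0<ε = 0<-* 0<ε (0<1/ₙ 3)

  module _ (x y : ℝ) (x≈y : x ≈ y) where

    even : ℕ → Bool
    even zero    = true
    even (suc n) = not (even n)

    zigzag : ℕ → ℚ
    zigzag i = if even i then seq x i else seq y i

    near-x : ∀ {ε} i → 0ℚ ≤ ε → ∣ seq x i - seq y i ∣ ≤ ε → ∣ zigzag i - seq x i ∣ ≤ ε
    near-x i 0≤ε close with even i
    ... | true  = subst (_≤ _) (cong ∣_∣ (sym (+-inverseʳ (seq x i)))) 0≤ε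
    ... | false = subst (_≤ _) (∣-∣-sym (seq x i) (seq y i)) close

    interleave : ℝ
    interleave = mkℝ zigzag λ ε 0<ε →
      let η = ε * 1/ₙ 3
          0<η = 0<1/₃ 0<ε
          (M , close)  = x≈y η 0<η
          (N , cauchy-x) = cauchy x η 0<η
      in M ℕ.⊔ N , λ i j i≥ j≥ →
        let near = λ k k≥ → near-x k (<⇒≤ 0<η) (close k (ℕ.m⊔n≤o⇒m≤o M N k≥))
            xi-xj = cauchy-x i j (ℕ.m⊔n≤o⇒n≤o M N i≥) (ℕ.m⊔n≤o⇒n≤o M N j≥)
        in begin
          ∣ zigzag i - zigzag j ∣
            ≤⟨ ∣-∣-triangle (zigzag i) (seq x j) (zigzag j) ⟩
          ∣ zigzag i - seq x j ∣ + ∣ seq x j - zigzag j ∣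
            ≤⟨ +-mono-≤ (∣-∣-triangle (zigzag i) (seq x i) (seq x j))
                 (≤-reflexive (∣-∣-sym (seq x j) (zigzag j))) ⟩
          ∣ zigzag i - seq x i ∣ + ∣ seq x i - seq x j ∣ + ∣ zigzag j - seq x j ∣
            ≤⟨ +-mono-≤ (+-mono-≤ (near i i≥) xi-xj) (near j j≥) ⟩
          η + η + η ≡⟨ 1/₃-sum ε ⟩
          ε ∎
      where open ≤-Reasoning

    -- A function taking Cauchy sequences to Cauchy sequences respects _≈_:
    -- apply it to the sequence alternating between x and y.
    cauchy-preserving⇒cong : ∀ (F : ℚ → ℚ) → (∀ z → Cauchy (λ i → F (seq z i))) →
      ∀ ε → 0ℚ < ε → Eventually (λ i → ∣ F (seq x i) - F (seq y i) ∣ ≤ ε)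
    cauchy-preserving⇒cong F F-cauchy ε 0<ε =
      let η = ε * 1/ₙ 3
          0<η = 0<1/₃ 0<ε
          (L , on-z) = F-cauchy interleave η 0<η
          (M , on-x) = F-cauchy x η 0<η
          (N , on-y) = F-cauchy y η 0<η
      in L ℕ.⊔ (M ℕ.⊔ N) , λ i i≥ →
        let i≥L  = ℕ.m⊔n≤o⇒m≤o L (M ℕ.⊔ N) i≥
            i≥MN = ℕ.m⊔n≤o⇒n≤o L (M ℕ.⊔ N) i≥
            i≥M  = ℕ.m⊔n≤o⇒m≤o M N i≥MN
            i≥N  = ℕ.m⊔n≤o⇒n≤o M N i≥MN
            up   = λ {k} (k≤i : k ℕ.≤ i) → ℕ.m≤n⇒m≤1+n k≤i
        in adjacent i (<⇒≤ 0<η) (on-z i (suc i) i≥L (up i≥L))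
             (on-x (suc i) i (up i≥M) i≥M) (on-y (suc i) i (up i≥N) i≥N)
      where
      open ≤-Reasoning
      adjacent : ∀ i → 0ℚ ≤ ε * 1/ₙ 3 → ∣ F (zigzag i) - F (zigzag (suc i)) ∣ ≤ ε * 1/ₙ 3 →
        ∣ F (seq x (suc i)) - F (seq x i) ∣ ≤ ε * 1/ₙ 3 →
        ∣ F (seq y (suc i)) - F (seq y i) ∣ ≤ ε * 1/ₙ 3 →
        ∣ F (seq x i) - F (seq y i) ∣ ≤ ε
      adjacent i 0≤η z-close x-close y-close with even i
      ... | true = begin
        ∣ F (seq x i) - F (seq y i) ∣ ≤⟨ ∣-∣-triangle (F (seq x i)) (F (seq y (suc i))) (F (seq y i)) ⟩
        _                             ≤⟨ +-mono-≤ z-close y-close ⟩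
        ε * 1/ₙ 3 + ε * 1/ₙ 3         ≤⟨ ≤-by (ε * 1/ₙ 3) 0≤η (sym (1/₃-sum ε)) ⟩
        ε                             ∎
      ... | false = begin
        ∣ F (seq x i) - F (seq y i) ∣ ≡⟨ ∣-∣-sym (F (seq x i)) (F (seq y i)) ⟩
        ∣ F (seq y i) - F (seq x i) ∣ ≤⟨ ∣-∣-triangle (F (seq y i)) (F (seq x (suc i))) (F (seq x i)) ⟩
        _                             ≤⟨ +-mono-≤ z-close x-close ⟩
        ε * 1/ₙ 3 + ε * 1/ₙ 3         ≤⟨ ≤-by (ε * 1/ₙ 3) 0≤η (sym (1/₃-sum ε)) ⟩
        ε                             ∎

-- Logarithm, exponential and seventh root, read off at single indices.

module Analysis where

  open Rationals
  open Sampling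
  open R using (ℝ; seq; cauchy; IsExp; IsLn; fromℕ; fromℚ)
  open import Data.Rational.Base hiding (_⊔_)
  open import Data.Rational.Properties hiding (_≟_)

  archimedean : ∀ q → ∃ λ n → q ≤ ι n
  archimedean q@(mkℚ a d c) = ℤ.∣ a ∣ , toℚᵘ-cancel-≤
    (ℚᵘ.≤-trans (ℚᵘ.*≤* (begin
      a ℤ.* ℤ.+ 1                  ≡⟨ ℤ.*-identityʳ a ⟩
      a                          ≤⟨ i≤+∣i∣ a ⟩
      ℤ.+ ℤ.∣ a ∣                  ≡⟨ ℤ.*-identityʳ (ℤ.+ ℤ.∣ a ∣) ⟨
      ℤ.+ ℤ.∣ a ∣ ℤ.* ℤ.+ 1          ≤⟨ ℤ.*-monoˡ-≤-nonNeg (ℤ.+ ℤ.∣ a ∣) (ℤ.+≤+ (ℕ.s≤s ℕ.z≤n)) ⟩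
      ℤ.+ ℤ.∣ a ∣ ℤ.* ℤ.+ suc d      ∎))
      (ℚᵘ.≤-reflexive (ℚᵘ.≃-sym (toℚᵘ-fromℚᵘ (ℚᵘ.mkℚᵘ (ℤ.+ ℤ.∣ a ∣) 0)))))
    where
    open ℤ.≤-Reasoning
    i≤+∣i∣ : ∀ i → i ℤ.≤ ℤ.+ ℤ.∣ i ∣
    i≤+∣i∣ (ℤ.+ _)      = ℤ.≤-refl
    i≤+∣i∣ ℤ.-[1+ _ ] = ℤ.-≤+

  archimedean-* : ∀ c {η} → 0ℚ < η → Eventually (λ m → c ≤ η * ι m)
  archimedean-* c {η} 0<η =
    let (N , c/η≤N) = archimedean (c * 1/η)
    in N , λ m N≤m → begin
      c                 ≡⟨ *-identityʳ c ⟨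
      c * 1ℚ            ≡⟨ cong (c *_) (*-inverseˡ η {{η≢0}}) ⟨
      c * (1/η * η)     ≡⟨ *-assoc c 1/η η ⟨
      c * 1/η * η       ≤⟨ *-monoˡ (<⇒≤ 0<η) (≤-trans c/η≤N (ι-mono N≤m)) ⟩
      ι m * η           ≡⟨ *-comm (ι m) η ⟩
      η * ι m           ∎
    where
    open ≤-Reasoning
    η≢0 : NonZero η
    η≢0 = pos⇒nonZero η {{positive 0<η}}
    1/η : ℚ
    1/η = (1/ η) {{η≢0}}

  -∣p∣≤p : ∀ p → - ∣ p ∣ ≤ p
  -∣p∣≤p p with ≤-total 0ℚ p
  ... | inj₁ 0≤p = ≤-trans (neg-antimono-≤ (0≤∣p∣ p)) 0≤p
  ... | inj₂ p≤0 = ≤-reflexive (trans (cong -_ (trans (sym (∣-p∣≡∣p∣ p)) (0≤p⇒∣p∣≡p (neg-antimono-≤ p≤0)))) (lem p))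
    where
    lem : ∀ p → - - p ≡ p
    lem = solve-∀ ℚ-ring

  p≤∣p∣ : ∀ p → p ≤ ∣ p ∣
  p≤∣p∣ p with ≤-total 0ℚ p
  ... | inj₁ 0≤p = ≤-reflexive (sym (0≤p⇒∣p∣≡p 0≤p))
  ... | inj₂ p≤0 = ≤-trans p≤0 (0≤∣p∣ p)

  ∣p-q∣≤r⇒q≤p+r : ∀ p q {r} → ∣ p - q ∣ ≤ r → q ≤ p + r
  ∣p-q∣≤r⇒q≤p+r p q {r} h = 0≤-⇒≤ (subst (0ℚ ≤_) (lem p q r) (≤⇒0≤- (≤-trans (neg-antimono-≤ h) (-∣p∣≤p (p - q)))))
    where
    lem : ∀ p q r → p - q - - r ≡ p + r - q
    lem = solve-∀ ℚ-ring

  ∣p-q∣≤r⇒p≤q+r : ∀ p q {r} → ∣ p - q ∣ ≤ r → p ≤ q + r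
  ∣p-q∣≤r⇒p≤q+r p q {r} h = 0≤-⇒≤ (subst (0ℚ ≤_) (lem p q r) (≤⇒0≤- (≤-trans (p≤∣p∣ (p - q)) h)))
    where
    lem : ∀ p q r → r - (p - q) ≡ q + r - p
    lem = solve-∀ ℚ-ring

  bounded : ∀ x → ∃ λ K → Eventually (λ i → - ι K ≤ seq x i × seq x i ≤ ι K)
  bounded x =
    let (N , close) = cauchy x 1ℚ (positive⁻¹ 1ℚ)
        (K , B≤K)   = archimedean (∣ seq x N ∣ + 1ℚ)
    in K , N , λ i N≤i →
      let h = close i N N≤i ℕ.≤-refl
          lower = begin
            - ι K                      ≤⟨ neg-antimono-≤ B≤K ⟩
            - (∣ seq x N ∣ + 1ℚ)       ≡⟨ neg-distrib-+ ∣ seq x N ∣ 1ℚ ⟩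
            - ∣ seq x N ∣ - 1ℚ         ≤⟨ +-monoˡ-≤ (- 1ℚ) (≤-trans (-∣p∣≤p (seq x N)) (∣p-q∣≤r⇒q≤p+r (seq x i) (seq x N) h)) ⟩
            seq x i + 1ℚ - 1ℚ          ≡⟨ lem (seq x i) ⟩
            seq x i                    ∎
          upper = ≤-trans (∣p-q∣≤r⇒p≤q+r (seq x i) (seq x N) h)
            (≤-trans (+-monoˡ-≤ 1ℚ (p≤∣p∣ (seq x N))) B≤K)
      in lower , upper
    where
    open ≤-Reasoning
    lem : ∀ a → a + 1ℚ - 1ℚ ≡ a
    lem = solve-∀ ℚ-ring

  seq-^ : ∀ x k i → seq (x R.^ k) i ≡ seq x i ^ k
  seq-^ x zero    i = refl
  seq-^ x (suc k) i = cong (seq x i *_) (seq-^ x k i)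

  compound : ℚ → ℕ → ℚ
  compound a m = (1ℚ + a * 1/ₙ (suc m)) ^ suc m

  seq-compound : ∀ x m i → seq ((R.1ℝ R.+ x R.÷ suc m) R.^ suc m) i ≡ compound (seq x i) m
  seq-compound x m i = seq-^ (R.1ℝ R.+ x R.÷ suc m) (suc m) i

  -- By monotonicity it suffices to take a = ½, where `^*[1-n*x]≤1` reads c · ½ ≤ 1. The lower bound
  -- on `a` keeps the base nonnegative, so that powers are monotone.
  compound-≤2 : ∀ {a} m → - ι (suc m) ≤ a → a ≤ ½ → compound a m ≤ ι 2
  compound-≤2 {a} m -m≤a a≤½ = begin
    compound a m           ≤⟨ ^-mono (suc m) 0≤base (+-monoʳ-≤ 1ℚ (*-monoˡ (0≤1/ₙ (suc m)) a≤½)) ⟩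
    c                      ≡⟨ lem c ⟩
    ι 2 * (c * ½)          ≤⟨ *-monoʳ (0≤ι 2) c½≤1 ⟩
    ι 2 * 1ℚ               ≡⟨⟩
    ι 2                    ∎
    where
    open ≤-Reasoning
    c : ℚ
    c = compound ½ m
    lem : ∀ c → c ≡ ι 2 * (c * ½)
    lem c = trans (sym (*-identityʳ c)) (lem′ c (ι 2) ½)
      where
      lem′ : ∀ c t h → c * (t * h) ≡ t * (c * h)
      lem′ = solve-∀ ℚ-ring
    0≤base : 0ℚ ≤ 1ℚ + a * 1/ₙ (suc m)
    0≤base = begin
      0ℚ                                       ≡⟨ +-inverseʳ 1ℚ ⟨
      1ℚ + - 1ℚ                                ≡⟨ cong (λ z → 1ℚ + - z) (ι*1/ₙ (suc m)) ⟨
      1ℚ + - (ι (suc m) * 1/ₙ (suc m))         ≡⟨ cong (1ℚ +_) (neg-distribˡ-* (ι (suc m)) (1/ₙ (suc m))) ⟩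
      1ℚ + - ι (suc m) * 1/ₙ (suc m)           ≤⟨ +-monoʳ-≤ 1ℚ (*-monoˡ (0≤1/ₙ (suc m)) -m≤a) ⟩
      1ℚ + a * 1/ₙ (suc m)                     ∎
    c½≤1 : c * ½ ≤ 1ℚ
    c½≤1 = subst (λ z → c * z ≤ 1ℚ) eq (^*[1-n*x]≤1 (suc m) (0≤-* (nonNegative⁻¹ ½) (0≤1/ₙ (suc m))))
      where
      eq : 1ℚ - ι (suc m) * (½ * 1/ₙ (suc m)) ≡ ½
      eq = trans (lem₂ (ι (suc m)) ½ (1/ₙ (suc m))) (cong (λ z → 1ℚ - ½ * z) (ι*1/ₙ (suc m)))
        where
        lem₂ : ∀ a h b → 1ℚ - a * (h * b) ≡ 1ℚ - h * (a * b)
        lem₂ = solve-∀ ℚ-ring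

  -- An entry below ½ would make the compound term at most 2. One unit is lost to the limit and one
  -- to the real inequality, so n ≤ 4 would follow; this is why 5 ≤ n is assumed.
  ½≤ln : ∀ {n x} → 5 ℕ.≤ n → IsLn (fromℕ n) x → Eventually (λ i → ½ ≤ seq x i)
  ½≤ln {n} {x} 5≤n isLn =
    let (K , x-bounded) = bounded x
        (M , converges) = isLn 1ℚ (positive⁻¹ 1ℚ)
        -- `M` makes the compound term close to n; `K` makes the base 1 + x/(m + 1) nonnegative.
        m = M ℕ.⊔ K
        n≤compound+1 = proj₂ (converges m (ℕ.m≤m⊔n M K)) 1ℚ (positive⁻¹ 1ℚ)
    in eventually-map (λ {i} ((-K≤x , _) , n≤) → ≮⇒≥ λ x<½ →
         n≰4 (≤-trans n≤ (+-monoˡ-≤ 1ℚ (+-monoˡ-≤ 1ℚ (≤-trans (≤-reflexive (seq-compound x m i))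
           (compound-≤2 m (≤-trans (neg-antimono-≤ (ι-mono (ℕ.≤-trans (ℕ.m≤n⊔m M K) (ℕ.n≤1+n m)))) -K≤x) (<⇒≤ x<½)))))))
         (x-bounded ⊗ n≤compound+1)
    where
    n≰4 : ι n ≤ ι 4 → ⊥
    n≰4 n≤4 = <-irrefl refl (≤-<-trans n≤4 (<-≤-trans 4<5 (ι-mono 5≤n)))
      where
      4<5 : ι 4 < ι 5
      4<5 = *<* (ℤ.+<+ (ℕ.≤ᵇ⇒≤ 5 5 _))

  -- A finite form of eᵃe⁻ᵃ = 1. With M = m + 1 and x = a/M the product is (1 - x²)ᴹ, and Bernoulli
  -- bounds it below by 1 - Mx² = 1 - a²/M. The term `1ℚ * a` carries the exponent γ′ = 1.
  compound-inverse : ∀ {a K η} m → 0ℚ ≤ a → a ≤ ι K → K ℕ.≤ suc m → ι K * ι K ≤ η * ι (suc m) →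
    let b = compound (- (1ℚ * a)) m in
    0ℚ ≤ b × compound a m * b ≤ 1ℚ × 1ℚ - η ≤ compound a m * b
  compound-inverse {a} {K} {η} m 0≤a a≤K K≤m K²≤ηm =
      subst (λ z → 0ℚ ≤ z ^ suc m) base (^-nonneg (suc m) (≤⇒0≤- x≤1))
    , subst (_≤ 1ℚ) product (^-≤1 (suc m) (≤⇒0≤- x²≤1) (≤-by (x * x) (0≤-² x) (lem₁ x)))
    , subst (1ℚ - η ≤_) product (≤-trans 1-η≤ (bernoulli-≤ (suc m) (neg-antimono-≤ x²≤1)))
    where
    open ≤-Reasoning
    M = suc m
    x = a * 1/ₙ M
    0≤x : 0ℚ ≤ x
    0≤x = 0≤-* 0≤a (0≤1/ₙ M)
    x≤1 : x ≤ 1ℚ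
    x≤1 = subst (x ≤_) (ι*1/ₙ M) (*-monoˡ (0≤1/ₙ M) (≤-trans a≤K (ι-mono K≤m)))
    x²≤1 : x * x ≤ 1ℚ
    x²≤1 = *-mono 0≤x 0≤1 x≤1 x≤1
    base : 1ℚ - x ≡ 1ℚ + - (1ℚ * a) * 1/ₙ M
    base = lem a (1/ₙ M)
      where
      lem : ∀ a i → 1ℚ - a * i ≡ 1ℚ + - (1ℚ * a) * i
      lem = solve-∀ ℚ-ring
    lem₁ : ∀ x → 1ℚ ≡ 1ℚ - x * x + x * x
    lem₁ = solve-∀ ℚ-ring
    product : (1ℚ - x * x) ^ M ≡ compound a m * compound (- (1ℚ * a)) m
    product = trans (cong (_^ M) (trans (lem x) (cong ((1ℚ + x) *_) base)))
      (^-distrib-* (1ℚ + x) (1ℚ + - (1ℚ * a) * 1/ₙ M) M)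
      where
      lem : ∀ x → 1ℚ - x * x ≡ (1ℚ + x) * (1ℚ - x)
      lem = solve-∀ ℚ-ring
    Mx²≤η : ι M * (x * x) ≤ η
    Mx²≤η = begin
      ι M * (x * x)                  ≡⟨ lem (ι M) a (1/ₙ M) ⟩
      a * a * 1/ₙ M * (ι M * 1/ₙ M)  ≡⟨ cong (a * a * 1/ₙ M *_) (ι*1/ₙ M) ⟩
      a * a * 1/ₙ M * 1ℚ             ≡⟨ *-identityʳ _ ⟩
      a * a * 1/ₙ M                  ≤⟨ *-monoˡ (0≤1/ₙ M) (≤-trans (*-mono 0≤a (0≤ι K) a≤K a≤K) K²≤ηm) ⟩
      η * ι M * 1/ₙ M                ≡⟨ *-assoc η (ι M) (1/ₙ M) ⟩
      η * (ι M * 1/ₙ M)              ≡⟨ cong (η *_) (ι*1/ₙ M) ⟩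
      η * 1ℚ                         ≡⟨ *-identityʳ η ⟩
      η                              ∎
      where
      lem : ∀ M a i → M * (a * i * (a * i)) ≡ a * a * i * (M * i)
      lem = solve-∀ ℚ-ring
    1-η≤ : 1ℚ - η ≤ 1ℚ + ι M * - (x * x)
    1-η≤ = ≤-trans (+-monoʳ-≤ 1ℚ (neg-antimono-≤ Mx²≤η)) (≤-reflexive (lem (ι M) (x * x)))
      where
      lem : ∀ M y → 1ℚ - M * y ≡ 1ℚ + M * - y
      lem = solve-∀ ℚ-ring

  -- Multiply by n: bn differs from 1 by at most |ab - 1| + b|a - n| ≤ 3η, where b ≤ 1 follows from
  -- a ≥ 1. Since n ≥ 1, the error can be enlarged to 3ηn and n cancelled.
  reciprocal-close : ∀ {a b η} n .{{_ : ℕ.NonZero n}} → 0ℚ ≤ η → 0ℚ ≤ b → 1ℚ ≤ a →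
    a * b ≤ 1ℚ → 1ℚ - η ≤ a * b → a ≤ ι n + (η + η) → ι n ≤ a + (η + η) →
    b ≤ 1/ₙ n + (η + η + η) × 1/ₙ n ≤ b + (η + η + η)
  reciprocal-close {a} {b} {η} n 0≤η 0≤b 1≤a ab≤1 1-η≤ab a≤ n≤ =
      *-cancel (0<ι n) (begin
        b * ι n                          ≤⟨ *-monoʳ 0≤b n≤ ⟩
        b * (a + (η + η))                ≡⟨ lem₁ a b η ⟩
        a * b + b * (η + η)              ≤⟨ +-mono-≤ ab≤1 (*-monoˡ 0≤2η b≤1) ⟩
        1ℚ + 1ℚ * (η + η)                ≤⟨ ≤-by η 0≤η (lem₂ η) ⟩
        1ℚ + (η + η + η) * 1ℚ            ≤⟨ +-monoʳ-≤ 1ℚ (*-monoʳ 0≤3η 1≤n) ⟩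
        1ℚ + (η + η + η) * ι n           ≡⟨ cong (_+ (η + η + η) * ι n) 1≡ ⟩
        1/ₙ n * ι n + (η + η + η) * ι n  ≡⟨ *-distribʳ-+ (ι n) (1/ₙ n) (η + η + η) ⟨
        (1/ₙ n + (η + η + η)) * ι n      ∎)
    , *-cancel (0<ι n) (begin
        1/ₙ n * ι n                      ≡⟨ 1≡ ⟨
        1ℚ                               ≡⟨ lem₃ η ⟩
        1ℚ - η + η                       ≤⟨ +-monoˡ-≤ η 1-η≤ab ⟩
        a * b + η                        ≤⟨ +-monoˡ-≤ η (*-monoˡ 0≤b a≤) ⟩
        (ι n + (η + η)) * b + η          ≡⟨ lem₄ (ι n) b η ⟩
        b * ι n + b * (η + η) + η        ≤⟨ +-monoˡ-≤ η (+-monoʳ-≤ (b * ι n) (*-monoˡ 0≤2η b≤1)) ⟩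
        b * ι n + 1ℚ * (η + η) + η       ≡⟨ lem₅ (b * ι n) η ⟩
        b * ι n + (η + η + η) * 1ℚ       ≤⟨ +-monoʳ-≤ (b * ι n) (*-monoʳ 0≤3η 1≤n) ⟩
        b * ι n + (η + η + η) * ι n      ≡⟨ *-distribʳ-+ (ι n) b (η + η + η) ⟨
        (b + (η + η + η)) * ι n          ∎)
    where
    open ≤-Reasoning
    0≤2η : 0ℚ ≤ η + η
    0≤2η = 0≤-+ 0≤η 0≤η
    0≤3η : 0ℚ ≤ η + η + η
    0≤3η = 0≤-+ 0≤2η 0≤η
    1≤n : 1ℚ ≤ ι n
    1≤n = ι-mono (ℕ.>-nonZero⁻¹ n)
    1≡ : 1ℚ ≡ 1/ₙ n * ι n
    1≡ = sym (trans (*-comm (1/ₙ n) (ι n)) (ι*1/ₙ n))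
    b≤1 : b ≤ 1ℚ
    b≤1 = ≤-trans (≤-reflexive (sym (*-identityˡ b))) (≤-trans (*-monoˡ 0≤b 1≤a) ab≤1)
    lem₁ : ∀ a b η → b * (a + (η + η)) ≡ a * b + b * (η + η)
    lem₁ = solve-∀ ℚ-ring
    lem₂ : ∀ η → 1ℚ + (η + η + η) * 1ℚ ≡ 1ℚ + 1ℚ * (η + η) + η
    lem₂ = solve-∀ ℚ-ring
    lem₃ : ∀ η → 1ℚ ≡ 1ℚ - η + η
    lem₃ = solve-∀ ℚ-ring
    lem₄ : ∀ n b η → (n + (η + η)) * b + η ≡ b * n + b * (η + η) + η
    lem₄ = solve-∀ ℚ-ring
    lem₅ : ∀ x η → x + 1ℚ * (η + η) + η ≡ x + (η + η + η) * 1ℚ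
    lem₅ = solve-∀ ℚ-ring

  exp-converges : ∀ {x y} → IsExp x (fromℚ y) → ∀ η → 0ℚ < η → Eventually (λ m →
    Eventually (λ i → compound (seq x i) m ≤ y + η + η) ×
    Eventually (λ i → y ≤ compound (seq x i) m + η + η))
  exp-converges {x} {y} isExp η 0<η =
    let (N , h) = isExp η 0<η
    in N , λ m N≤m →
      let (M₁ , upper) = proj₁ (h m N≤m) η 0<η
          (M₂ , lower) = proj₂ (h m N≤m) η 0<η
      in (M₁ , λ i M₁≤i → subst (_≤ y + η + η) (seq-compound x m i) (upper i M₁≤i))
       , (M₂ , λ i M₂≤i → subst (λ z → y ≤ z + η + η) (seq-compound x m i) (lower i M₂≤i))

  converges-exp : ∀ {x y} → (∀ ε → 0ℚ < ε → Eventually (λ m →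
      Eventually (λ i → compound (seq x i) m ≤ y + ε × y ≤ compound (seq x i) m + ε))) →
    IsExp x (fromℚ y)
  converges-exp {x} {y} close ε 0<ε =
    let (N , h) = close ε 0<ε
    in N , λ m N≤m →
      let (M , close-at) = h m N≤m
      in (λ δ 0<δ → M , λ i M≤i → subst (_≤ y + ε + δ) (sym (seq-compound x m i))
            (≤-trans (proj₁ (close-at i M≤i)) (≤-by δ (<⇒≤ 0<δ) refl)))
       , (λ δ 0<δ → M , λ i M≤i → subst (λ z → y ≤ z + ε + δ) (sym (seq-compound x m i))
            (≤-trans (proj₂ (close-at i M≤i)) (≤-by δ (<⇒≤ 0<δ) refl)))

  close-at : ∀ n .{{_ : ℕ.NonZero n}} a m K {ε} → 0ℚ < ε → let η = ε * 1/ₙ 3; b = compound (- (1ℚ * a)) m in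
    K ℕ.≤ suc m → ι K * ι K ≤ η * ι (suc m) → a ≤ ι K → ½ ≤ a →
    compound a m ≤ ι n + η + η → ι n ≤ compound a m + η + η →
    b ≤ 1/ₙ n + ε × 1/ₙ n ≤ b + ε
  close-at n a m K {ε} 0<ε K≤m K²≤ a≤K ½≤a A≤ n≤A =
    let η = ε * 1/ₙ 3
        b = compound (- (1ℚ * a)) m
        0≤a = ≤-trans (nonNegative⁻¹ ½) ½≤a
        (0≤b , ab≤1 , 1-η≤ab) = compound-inverse {η = η} m 0≤a a≤K K≤m K²≤
        (b≤ , ≤b) = reciprocal-close n (<⇒≤ (0<1/₃ 0<ε)) 0≤b
          (1≤^ (suc m) (≤-by (a * 1/ₙ (suc m)) (0≤-* 0≤a (0≤1/ₙ (suc m))) refl)) ab≤1 1-η≤ab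
          (subst (compound a m ≤_) (+-assoc (ι n) η η) A≤)
          (subst (ι n ≤_) (+-assoc (compound a m) η η) n≤A)
    in subst (λ z → b ≤ 1/ₙ n + z) (1/₃-sum ε) b≤ , subst (λ z → 1/ₙ n ≤ b + z) (1/₃-sum ε) ≤b

  -- Uses that the compound terms of the logarithm tend to n and are nearly inverse to those of its
  -- negative. Fuel for the second fact is ½ ≤ ln n, which makes the entries nonnegative.
  exp-neg : ∀ {n} .{{_ : ℕ.NonZero n}} {x} → 5 ℕ.≤ n → IsLn (fromℕ n) x →
    IsExp (R.- (R.1ℝ R.* x)) (fromℚ (1/ₙ n))
  exp-neg {n} {x} 5≤n isLn = converges-exp {R.- (R.1ℝ R.* x)} {1/ₙ n} λ ε 0<ε →
    let η = ε * 1/ₙ 3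
        0<η = 0<1/₃ 0<ε
        (K , x-bounded)  = bounded x
        (M , converges)  = exp-converges {x} {ι n} isLn η 0<η
        (N , archimedes) = archimedean-* (ι K * ι K) 0<η
    in K ℕ.⊔ (M ℕ.⊔ N) , λ m m≥ →
      let K≤m  = ℕ.m⊔n≤o⇒m≤o K (M ℕ.⊔ N) m≥
          MN≤m = ℕ.m⊔n≤o⇒n≤o K (M ℕ.⊔ N) m≥
          (upper , lower) = converges m (ℕ.m⊔n≤o⇒m≤o M N MN≤m)
      in eventually-map
           (λ {i} ((_ , x≤K) , ½≤x , A≤ , n≤A) → close-at n (seq x i) m K 0<ε (ℕ.m≤n⇒m≤1+n K≤m)
              (archimedes (suc m) (ℕ.m≤n⇒m≤1+n (ℕ.m⊔n≤o⇒n≤o M N MN≤m))) x≤K ½≤x A≤ n≤A)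
           (x-bounded ⊗ ½≤ln {n} {x} 5≤n isLn ⊗ upper ⊗ lower)

  -- The sign of a single entry r is not known in advance. A negative r has a nonpositive odd power,
  -- and for 0 ≤ r < t ≤ 1 the power is at most r.
  t≤r^7⇒t≤r : ∀ {t r} → 0ℚ < t → t ≤ 1ℚ → t ≤ r ^ 7 → t ≤ r
  t≤r^7⇒t≤r {t} {r} 0<t t≤1 t≤r⁷ = ≮⇒≥ λ r<t → <-irrefl refl (≤-<-trans t≤r⁷ (below r<t))
    where
    below : r < t → r ^ 7 < t
    below r<t with ≤-total 0ℚ r
    ... | inj₁ 0≤r = ≤-<-trans (≤-trans (*-monoʳ 0≤r (^-≤1 6 0≤r (≤-trans (<⇒≤ r<t) t≤1))) (≤-reflexive (*-identityʳ r))) r<t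
    ... | inj₂ r≤0 = ≤-<-trans (≤-trans (*-monoˡ 0≤r⁶ r≤0) (≤-reflexive (*-zeroˡ (r ^ 6)))) 0<t
      where
      0≤r⁶ : 0ℚ ≤ r ^ 6
      0≤r⁶ = subst (0ℚ ≤_) (sym (^-homo-* r 3 3)) (0≤-² (r ^ 3))

  module _ (n : ℕ) .{{_ : ℕ.NonZero n}} where

    -- The tolerance with which real inequalities are read at an index: 3/(2n) ≤ r⁷ + 1/(2n) leaves
    -- 1/n ≤ r⁷, and two such errors together are only 1/n.
    halfStep : ℚ
    halfStep = ½ * 1/ₙ n

    0<halfStep : 0ℚ < halfStep
    0<halfStep = 0<-* (positive⁻¹ ½) (0<1/ₙ n)

    halfStep+halfStep : halfStep + halfStep ≡ 1/ₙ n
    halfStep+halfStep = trans (sym (*-distribʳ-+ (1/ₙ n) ½ ½)) (*-identityˡ (1/ₙ n))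

    1/ₙ≤1 : 1/ₙ n ≤ 1ℚ
    1/ₙ≤1 = *-cancel (0<ι n) (begin
      1/ₙ n * ι n  ≡⟨ trans (*-comm (1/ₙ n) (ι n)) (ι*1/ₙ n) ⟩
      1ℚ           ≤⟨ ι-mono (ℕ.>-nonZero⁻¹ n) ⟩
      ι n          ≡⟨ *-identityˡ (ι n) ⟨
      1ℚ * ι n     ∎)
      where open ≤-Reasoning

    edgeDensity : ∀ {g x r p} → ι 3 ≤ g → ½ ≤ x → g * x * 1/ₙ n ≤ r ^ 7 + halfStep →
      ι 7 * r ≤ p + halfStep → p ≤ 1ℚ + halfStep →
      0ℚ ≤ p × 0ℚ ≤ p ⊓ 1ℚ × 1ℚ ≤ ι (3 ℕ.* n) * ((p ⊓ 1ℚ) * 1/ₙ 7) ^ 7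
    edgeDensity {g} {x} {r} {p} 3≤g ½≤x gx/n≤ 7r≤ p≤ = ≤-trans 0≤6r 6r≤p , 0≤c , (begin
      -- A closed rational comparison: 3 · 6⁷ = 839808 exceeds 7⁷ = 823543. The 6 comes from 6r ≤ p,
      -- the 7 from the share of labels in a window.
      1ℚ                                     ≤⟨ ≤ᵇ⇒≤ _ ⟩
      ι 3 * (ι 6 * 1/ₙ 7) ^ 7                ≡⟨ *-identityʳ _ ⟨
      ι 3 * (ι 6 * 1/ₙ 7) ^ 7 * 1ℚ           ≡⟨ cong (λ z → ι 3 * (ι 6 * 1/ₙ 7) ^ 7 * z) (ι*1/ₙ n) ⟨
      ι 3 * (ι 6 * 1/ₙ 7) ^ 7 * (ι n * 1/ₙ n) ≡⟨ lem₁ (ι 3) ((ι 6 * 1/ₙ 7) ^ 7) (ι n) (1/ₙ n) ⟩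
      ι 3 * ι n * ((ι 6 * 1/ₙ 7) ^ 7 * 1/ₙ n) ≤⟨ *-monoʳ (0≤-* (0≤ι 3) (0≤ι n)) (*-monoʳ (^-nonneg 7 (0≤-* (0≤ι 6) (0≤1/ₙ 7))) 1/n≤r⁷) ⟩
      ι 3 * ι n * ((ι 6 * 1/ₙ 7) ^ 7 * r ^ 7) ≡⟨ cong (ι 3 * ι n *_) (^-distrib-* (ι 6 * 1/ₙ 7) r 7) ⟨
      ι 3 * ι n * (ι 6 * 1/ₙ 7 * r) ^ 7       ≤⟨ *-monoʳ (0≤-* (0≤ι 3) (0≤ι n)) (^-mono 7 (0≤-* (0≤-* (0≤ι 6) (0≤1/ₙ 7)) 0≤r) 6r/7≤c/7) ⟩
      ι 3 * ι n * ((p ⊓ 1ℚ) * 1/ₙ 7) ^ 7      ≡⟨ cong (_* ((p ⊓ 1ℚ) * 1/ₙ 7) ^ 7) (ι-* 3 n) ⟨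
      ι (3 ℕ.* n) * ((p ⊓ 1ℚ) * 1/ₙ 7) ^ 7    ∎)
      where
      open ≤-Reasoning
      lem₁ : ∀ a b c d → a * b * (c * d) ≡ a * c * (b * d)
      lem₁ = solve-∀ ℚ-ring
      1/n≤r⁷ : 1/ₙ n ≤ r ^ 7
      1/n≤r⁷ = 0≤-⇒≤ (subst (0ℚ ≤_) (lem halfStep (1/ₙ n) (r ^ 7) halfStep+halfStep)
        (≤⇒0≤- (≤-trans (*-monoˡ (0≤1/ₙ n) (*-mono (0≤ι 3) 0≤x 3≤g ½≤x)) gx/n≤)))
        where
        0≤x : 0ℚ ≤ x
        0≤x = ≤-trans (nonNegative⁻¹ ½) ½≤x
        lem : ∀ h t w → h + h ≡ t → w + h - ι 3 * ½ * t ≡ w - t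
        lem h t w refl = trans (cong (λ z → w + h - z) (*-distribˡ-+ (ι 3 * ½) h h))
          (trans (cong (λ z → w + h - z) (trans (sym (*-distribʳ-+ h (ι 3 * ½) (ι 3 * ½))) (lem′ h))) (lem″ w h))
          where
          lem′ : ∀ h → (1ℚ + 1ℚ + 1ℚ) * h ≡ h + h + h
          lem′ = solve-∀ ℚ-ring
          lem″ : ∀ w h → w + h - (h + h + h) ≡ w - (h + h)
          lem″ = solve-∀ ℚ-ring
      1/n≤r : 1/ₙ n ≤ r
      1/n≤r = t≤r^7⇒t≤r (0<1/ₙ n) 1/ₙ≤1 1/n≤r⁷
      0≤r : 0ℚ ≤ r
      0≤r = ≤-trans (0≤1/ₙ n) 1/n≤r
      0≤6r : 0ℚ ≤ ι 6 * r
      0≤6r = 0≤-* (0≤ι 6) 0≤r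
      -- The accumulated error 1/n is at most r, so one of the seven copies of r pays for it.
      6r≤ : ∀ {z} → ι 7 * r ≤ z + 1/ₙ n → ι 6 * r ≤ z
      6r≤ {z} h = 0≤-⇒≤ (subst (0ℚ ≤_) (trans (cong (λ w → z + r - w) 7r≡) (lem z r (ι 6 * r)))
        (≤⇒0≤- (≤-trans h (+-monoʳ-≤ z 1/n≤r))))
        where
        7r≡ : ι 7 * r ≡ ι 6 * r + r
        7r≡ = trans (*-distribʳ-+ r (ι 6) 1ℚ) (cong (ι 6 * r +_) (*-identityˡ r))
        lem : ∀ z r s → z + r - (s + r) ≡ z - s
        lem = solve-∀ ℚ-ring
      6r≤p : ι 6 * r ≤ p
      6r≤p = 6r≤ (≤-trans 7r≤ (+-monoʳ-≤ p (≤-by halfStep (<⇒≤ 0<halfStep) (sym halfStep+halfStep))))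
      6r≤1 : ι 6 * r ≤ 1ℚ
      6r≤1 = 6r≤ (≤-trans 7r≤ (≤-trans (+-monoˡ-≤ halfStep p≤)
        (≤-reflexive (trans (+-assoc 1ℚ halfStep halfStep) (cong (1ℚ +_) halfStep+halfStep)))))
      6r≤c : ι 6 * r ≤ p ⊓ 1ℚ
      6r≤c = ⊓-glb 6r≤p 6r≤1
      0≤c : 0ℚ ≤ p ⊓ 1ℚ
      0≤c = ≤-trans 0≤6r 6r≤c
      6r/7≤c/7 : ι 6 * 1/ₙ 7 * r ≤ (p ⊓ 1ℚ) * 1/ₙ 7
      6r/7≤c/7 = ≤-trans (≤-reflexive (lem (ι 6) (1/ₙ 7) r)) (*-monoˡ (0≤1/ₙ 7) 6r≤c)
        where
        lem : ∀ a b r → a * b * r ≡ a * r * b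
        lem = solve-∀ ℚ-ring

-- Passage from rational entries to the real probability and size bounds.

module Transfer where

  open Rationals
  open Expectation
  open Avoidance
  open Hub
  open Success
  open Analysis
  open Sampling
  open R using (ℝ; mkℝ; seq; cauchy; Cauchy; IsLn; IsRoot; fromℕ; fromℚ; _≈_; ℙ; labelledG;
                possibleEdges; TemporalGraph; Needs; ProbabilityAtLeast)
  open import Data.Rational.Base hiding (_⊔_)
  open import Data.Rational.Properties hiding (_≟_)

  ∣-∣-≤ : ∀ {p q r} → p ≤ q + r → q ≤ p + r → ∣ p - q ∣ ≤ r
  ∣-∣-≤ {p} {q} {r} p≤q+r q≤p+r with ∣p∣≡p∨∣p∣≡-p (p - q)
  ... | inj₁ eq = ≤-trans (≤-reflexive eq) (0≤-⇒≤ (subst (0ℚ ≤_) (lem p q r) (≤⇒0≤- p≤q+r)))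
    where
    lem : ∀ p q r → q + r - p ≡ r - (p - q)
    lem = solve-∀ ℚ-ring
  ... | inj₂ eq = ≤-trans (≤-reflexive eq) (0≤-⇒≤ (subst (0ℚ ≤_) (lem p q r) (≤⇒0≤- q≤p+r)))
    where
    lem : ∀ p q r → p + r - q ≡ r - - (p - q)
    lem = solve-∀ ℚ-ring

  ⊓1-mono : ∀ a b {r} → 0ℚ ≤ r → b ≤ a + r → b ⊓ 1ℚ ≤ a ⊓ 1ℚ + r
  ⊓1-mono a b {r} 0≤r b≤a+r with ≤-total a 1ℚ
  ... | inj₁ a≤1 = ≤-trans (p⊓q≤p b 1ℚ) (≤-trans b≤a+r (+-monoˡ-≤ r (≤-reflexive (sym (p≤q⇒p⊓q≡p a≤1)))))
  ... | inj₂ 1≤a = ≤-trans (p⊓q≤q b 1ℚ) (≤-trans (≤-by r 0≤r refl) (+-monoˡ-≤ r (≤-reflexive (sym (p≥q⇒p⊓q≡q 1≤a)))))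

  -- When x ≤ 1 this is the same real number, but now no entry exceeds 1, as the nonnegativity of
  -- the expectation requires.
  clamp : ℝ → ℝ
  clamp x = mkℝ (λ i → seq x i ⊓ 1ℚ) λ ε 0<ε →
    let (N , close) = cauchy x ε 0<ε
    in N , λ i j N≤i N≤j →
      let h = close i j N≤i N≤j
      in ∣-∣-≤ (⊓1-mono (seq x j) (seq x i) (<⇒≤ 0<ε) (∣p-q∣≤r⇒p≤q+r (seq x i) (seq x j) h))
               (⊓1-mono (seq x i) (seq x j) (<⇒≤ 0<ε) (∣p-q∣≤r⇒q≤p+r (seq x i) (seq x j) h))

  ≈clamp : ∀ x → x R.≤ R.1ℝ → x ≈ clamp x
  ≈clamp x x≤1 ε 0<ε = eventually-map
    (λ {i} h → ∣-∣-≤ (below (seq x i) (<⇒≤ 0<ε) h) (≤-trans (p⊓q≤p (seq x i) 1ℚ) (≤-by ε (<⇒≤ 0<ε) refl)))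
    (x≤1 ε 0<ε)
    where
    below : ∀ p {ε} → 0ℚ ≤ ε → p ≤ 1ℚ + ε → p ≤ p ⊓ 1ℚ + ε
    below p {ε} 0≤ε h with ≤-total p 1ℚ
    ... | inj₁ p≤1 = ≤-trans (≤-by ε 0≤ε refl) (+-monoˡ-≤ ε (≤-reflexive (sym (p≤q⇒p⊓q≡p p≤1))))
    ... | inj₂ 1≤p = ≤-trans h (+-monoˡ-≤ ε (≤-reflexive (sym (p≥q⇒p⊓q≡q 1≤p))))

  -- The bound 2 concerns the unclamped entry, which may exceed 1 and which occurs in the size
  -- estimate through p⁵.
  Dense : ℕ → ℚ → Set
  Dense n p = 0ℚ ≤ p × p ≤ ι 2 × 0ℚ ≤ p ⊓ 1ℚ × 1ℚ ≤ ι (3 ℕ.* n) * ((p ⊓ 1ℚ) * 1/ₙ 7) ^ 7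

  dense : ∀ {n} .{{_ : ℕ.NonZero n}} {γ p x r} → 5 ℕ.≤ n → fromℕ 3 R.< γ →
    IsLn (fromℕ n) x → IsRoot 7 ((γ R.* x) R.÷ n) r → fromℕ 7 R.* r R.≤ p → p R.≤ R.1ℝ →
    Eventually (λ i → Dense n (seq p i))
  dense {n} {γ} {p} {x} {r} 5≤n (ε , 0<ε , γ>3) isLn (_ , r⁷≈) 7r≤p p≤1 = eventually-map combine
    (γ>3 ⊗ ½≤ln {n} {x} 5≤n isLn ⊗ r⁷≈ h 0<h ⊗ 7r≤p h 0<h ⊗ p≤1 h 0<h)
    where
    h : ℚ
    h = halfStep n
    0<h : 0ℚ < h
    0<h = 0<halfStep n
    h≤1 : h ≤ 1ℚ
    h≤1 = ≤-trans (≤-by h (<⇒≤ 0<h) (sym (halfStep+halfStep n))) (1/ₙ≤1 n)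
    combine : ∀ {i} → ι 3 + ε ≤ seq γ i × ½ ≤ seq x i ×
      ∣ seq (r R.^ 7) i - seq γ i * seq x i * 1/ₙ n ∣ ≤ h ×
      ι 7 * seq r i ≤ seq p i + h × seq p i ≤ 1ℚ + h → Dense n (seq p i)
    combine {i} (3<γ , ½≤x , close , 7r≤ , p≤) =
      let (0≤p , rest) = edgeDensity n {seq γ i} {seq x i} {seq r i} {seq p i}
            (≤-trans (≤-by ε (<⇒≤ 0<ε) refl) 3<γ) ½≤x
            (subst (λ z → seq γ i * seq x i * 1/ₙ n ≤ z + h) (seq-^ r 7 i)
              (∣p-q∣≤r⇒q≤p+r (seq (r R.^ 7) i) _ close)) 7r≤ p≤
      in 0≤p , ≤-trans p≤ (+-monoʳ-≤ 1ℚ h≤1) , rest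

  module _ {k α : ℕ} .{{nz : ℕ.NonZero α}} (4≤α : 4 ℕ.≤ α) where

    private
      n : ℕ
      n = suc (suc k)

    goodSet : TemporalGraph n → Bool
    goodSet = good k (quarter α {{nz}} 4≤α)

    goodProbability : ℚ → ℚ
    goodProbability q = 𝔼 α q (possibleEdges n) (λ I → 𝟙 (goodSet I))

    -- The probability at `z` is already a real number with exactly these entries, so its own Cauchy
    -- proof serves and no modulus of continuity is computed.
    goodProbability-cauchy : ∀ z → Cauchy (λ i → goodProbability (seq z i))
    goodProbability-cauchy z ε 0<ε =
      let (N , close) = cauchy (ℙ (labelledG n z α) goodSet) ε 0<ε
      in N , λ i j N≤i N≤j → subst₂ (λ a b → ∣ a - b ∣ ≤ ε)
        (seq-ℙ-labelledG i α z goodSet) (seq-ℙ-labelledG j α z goodSet) (close i j N≤i N≤j)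

    1-2/n≤ℙ : ∀ {p i ε} → 320 ℕ.≤ n → Dense n (seq p i) →
      ∣ goodProbability (seq p i) - goodProbability (seq p i ⊓ 1ℚ) ∣ ≤ ε →
      1ℚ - ι 2 * 1/ₙ n ≤ seq (ℙ (labelledG n p α {{nz}}) goodSet) i + ε
    1-2/n≤ℙ {p} {i} {ε} 320≤n (_ , _ , 0≤c , h) close = ≤-trans
      (good-likely α {{nz}} 4≤α k 0≤c (p⊓q≤q (seq p i) 1ℚ) 320≤n h)
      (subst (λ z → goodProbability (seq p i ⊓ 1ℚ) ≤ z + ε) (sym (seq-ℙ-labelledG i α {{nz}} p goodSet))
        (∣p-q∣≤r⇒q≤p+r (goodProbability (seq p i)) (goodProbability (seq p i ⊓ 1ℚ)) close))

    ℙ-good : ∀ {p} → 320 ℕ.≤ n → p R.≤ R.1ℝ → Eventually (λ i → Dense n (seq p i)) →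
      R.1ℝ R.- fromℕ 2 R.* fromℚ (1/ₙ n) R.≤ ℙ (labelledG n p α {{nz}}) goodSet
    ℙ-good {p} 320≤n p≤1 p-dense ε 0<ε =
      let (N , h) = p-dense ⊗ cauchy-preserving⇒cong p (clamp p) (≈clamp p p≤1)
                      goodProbability goodProbability-cauchy ε 0<ε
      in N , λ i N≤i → 1-2/n≤ℙ {p} {i} 320≤n (proj₁ (h i N≤i)) (proj₂ (h i N≤i))

  module _ (n : ℕ) (p : ℝ) (p-dense : Eventually (λ i → Dense n (seq p i))) where

    -- Entries of `p` are at most 2, so n + np⁵ ≤ 33n, and n ≤ 2m gives 33 · 2 = 66.
    size-lower : ∀ m → n ℕ.≤ m ℕ.* 2 →
      fromℚ (1/ₙ 66) R.* (fromℕ n R.+ fromℕ n R.* p R.^ 5) R.≤ fromℕ m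
    size-lower m n≤2m ε 0<ε = eventually-map
      (λ {i} (0≤p , p≤2 , _) → ≤-trans (subst (λ P → 1/ₙ 66 * (ι n + ι n * P) ≤ ι m) (sym (seq-^ p 5 i)) (bound 0≤p p≤2))
        (≤-by ε (<⇒≤ 0<ε) refl)) p-dense
      where
      open ≤-Reasoning
      bound : ∀ {p} → 0ℚ ≤ p → p ≤ ι 2 → 1/ₙ 66 * (ι n + ι n * p ^ 5) ≤ ι m
      bound {p} 0≤p p≤2 = begin
        1/ₙ 66 * (ι n + ι n * p ^ 5)    ≤⟨ *-monoʳ (0≤1/ₙ 66) (+-monoʳ-≤ (ι n) (*-monoʳ (0≤ι n) (^-mono 5 0≤p p≤2))) ⟩
        1/ₙ 66 * (ι n + ι n * ι 32)     ≡⟨ cong (λ z → 1/ₙ 66 * (ι n + z)) (ι-* n 32) ⟨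
        1/ₙ 66 * (ι n + ι (n ℕ.* 32))   ≡⟨ cong (1/ₙ 66 *_) (ι-+ n (n ℕ.* 32)) ⟨
        1/ₙ 66 * ι (n ℕ.+ n ℕ.* 32)     ≤⟨ *-monoʳ (0≤1/ₙ 66) (ι-mono (≤-ℕ n≤2m)) ⟩
        1/ₙ 66 * ι (m ℕ.* 66)           ≡⟨ cong (1/ₙ 66 *_) (ι-* m 66) ⟩
        1/ₙ 66 * (ι m * ι 66)           ≡⟨ lem (1/ₙ 66) (ι m) (ι 66) ⟩
        ι 66 * 1/ₙ 66 * ι m             ≡⟨ cong (_* ι m) (ι*1/ₙ 66) ⟩
        1ℚ * ι m                        ≡⟨ *-identityˡ (ι m) ⟩
        ι m                             ∎
        where
        lem : ∀ a b c → a * (b * c) ≡ c * a * b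
        lem = solve-∀ ℚ-ring
        ≤-ℕ : n ℕ.≤ m ℕ.* 2 → n ℕ.+ n ℕ.* 32 ℕ.≤ m ℕ.* 66
        ≤-ℕ n≤2m = ℕ.≤-trans (ℕ.≤-reflexive (sym (ℕ.*-suc n 32)))
          (ℕ.≤-trans (ℕ.*-monoˡ-≤ 33 n≤2m) (ℕ.≤-reflexive (ℕ.*-assoc m 2 33)))

    size-upper : ∀ m → m ℕ.≤ n ℕ.* 4 →
      fromℕ m R.≤ fromℕ 4 R.* (fromℕ n R.+ fromℕ n R.* p R.^ 5)
    size-upper m m≤4n ε 0<ε = eventually-map
      (λ {i} (0≤p , _) → ≤-trans (subst (λ P → ι m ≤ ι 4 * (ι n + ι n * P)) (sym (seq-^ p 5 i)) (bound 0≤p))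
        (≤-by ε (<⇒≤ 0<ε) refl)) p-dense
      where
      open ≤-Reasoning
      bound : ∀ {p} → 0ℚ ≤ p → ι m ≤ ι 4 * (ι n + ι n * p ^ 5)
      bound {p} 0≤p = begin
        ι m                         ≤⟨ ι-mono m≤4n ⟩
        ι (n ℕ.* 4)                 ≡⟨ ι-* n 4 ⟩
        ι n * ι 4                   ≡⟨ *-comm (ι n) (ι 4) ⟩
        ι 4 * ι n                   ≤⟨ *-monoʳ (0≤ι 4) (≤-by {ι n} (ι n * p ^ 5) (0≤-* (0≤ι n) (^-nonneg 5 0≤p)) refl) ⟩
        ι 4 * (ι n + ι n * p ^ 5)   ∎

  0<fromℚ : ∀ {q} → 0ℚ < q → R.0ℝ R.< fromℚ q
  0<fromℚ {q} 0<q = q , 0<q , 0 , λ _ _ → ≤-reflexive (+-identityˡ q)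

  ≤-reflℝ : ∀ q → fromℚ q R.≤ fromℚ q
  ≤-reflℝ q ε 0<ε = 0 , λ _ _ → ≤-by ε (<⇒≤ 0<ε) refl

  likely : ∀ n α .{{_ : ℕ.NonZero n}} .{{_ : ℕ.NonZero α}} p → 320 ℕ.≤ n → 4 ℕ.≤ α → p R.≤ R.1ℝ →
    Eventually (λ i → Dense n (seq p i)) →
    ProbabilityAtLeast (R.1ℝ R.- fromℕ 2 R.* fromℚ (1/ₙ n)) (labelledG n p α)
      (λ I → Σ[ m ∈ ℕ ] Needs I m ×
        (fromℚ (1/ₙ 66) R.* (fromℕ n R.+ fromℕ n R.* p R.^ 5) R.≤ fromℕ m) ×
        (fromℕ m R.≤ fromℕ 4 R.* (fromℕ n R.+ fromℕ n R.* p R.^ 5)))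
  likely (suc zero)    α p (ℕ.s≤s ()) _ _ _
  likely (suc (suc k)) α p 320≤n 4≤α p≤1 p-dense =
      goodSet 4≤α
    , (λ I h → let (m , needs-m , m≤4n , n≤2m) = good⇒needs k (quarter α 4≤α) I h
               in m , needs-m , size-lower (suc (suc k)) p p-dense m n≤2m , size-upper (suc (suc k)) p p-dense m m≤4n)
    , ℙ-good 4≤α {p} 320≤n p≤1 p-dense

-- Assembly of the theorem with γ′ = 1.

open Rationals using (1/ₙ; ι; 0<1/ₙ; 0<ι)
open Analysis using (exp-neg)
open Transfer using (dense; likely; 0<fromℚ; ≤-reflℝ)
open import Defs
open import Data.Nat.Base as ℕ using (ℕ; NonZero)
open import Data.Product using (Σ-syntax; _×_)

theorem8 : Σ[ c₁ ∈ ℝ ] Σ[ c₂ ∈ ℝ ] Σ[ n₀ ∈ ℕ ] (0ℝ < c₁) × (0ℝ < c₂) ×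
    (∀ (γ : ℝ) → fromℕ 3 < γ →
    Σ[ γ′ ∈ ℝ ] (1ℝ ≤ γ′) ×
    (∀ (n α : ℕ) .{{_ : NonZero n}} .{{_ : NonZero α}} (p ln-n root : ℝ) →
    n₀ ℕ.≤ n → 4 ℕ.≤ α → 0ℝ ≤ p → p ≤ 1ℝ →
    IsLn (fromℕ n) ln-n →
    IsRoot 7 ((γ * ln-n) ÷ n) root →
    fromℕ 7 * root ≤ p →
    Σ[ n^-γ′ ∈ ℝ ] IsExp (- (γ′ * ln-n)) n^-γ′ ×
    ProbabilityAtLeast (1ℝ - fromℕ 2 * n^-γ′) (labelledG n p α)
    (λ I → Σ[ m ∈ ℕ ] Needs I m ×
    (c₁ * (fromℕ n + fromℕ n * p ^ 5) ≤ fromℕ m) ×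
    (fromℕ m ≤ c₂ * (fromℕ n + fromℕ n * p ^ 5)))))
theorem8 =
    -- The upper constant 4 counts the time-edges chosen for each vertex other than the hub: two on
    -- the way in, two on the way out.
    fromℚ (1/ₙ 66) , fromℕ 4 , 320 , 0<fromℚ (0<1/ₙ 66) , 0<fromℚ (0<ι 4)
  , λ γ 3<γ → 1ℝ , ≤-reflℝ (ι 1) , λ n α {{n≢0}} {{α≢0}} → bound γ 3<γ n α {{n≢0}} {{α≢0}}
  where
  bound : ∀ γ → fromℕ 3 < γ → ∀ n α .{{_ : NonZero n}} .{{_ : NonZero α}} p ln-n root →
    320 ℕ.≤ n → 4 ℕ.≤ α → 0ℝ ≤ p → p ≤ 1ℝ → IsLn (fromℕ n) ln-n →
    IsRoot 7 ((γ * ln-n) ÷ n) root → fromℕ 7 * root ≤ p →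
    Σ[ n^-γ′ ∈ ℝ ] IsExp (- (1ℝ * ln-n)) n^-γ′ ×
    ProbabilityAtLeast (1ℝ - fromℕ 2 * n^-γ′) (labelledG n p α)
      (λ I → Σ[ m ∈ ℕ ] Needs I m ×
        (fromℚ (1/ₙ 66) * (fromℕ n + fromℕ n * p ^ 5) ≤ fromℕ m) ×
        (fromℕ m ≤ fromℕ 4 * (fromℕ n + fromℕ n * p ^ 5)))
  bound γ 3<γ n α {{n≢0}} {{α≢0}} p ln-n root 320≤n 4≤α 0≤p p≤1 isLn isRoot 7root≤p =
      fromℚ (1/ₙ n) , exp-neg {n} {{n≢0}} {ln-n} 5≤n isLn
    , likely n α {{n≢0}} {{α≢0}} p 320≤n 4≤α p≤1
        (dense {n} {{n≢0}} {γ} {p} {ln-n} {root} 5≤n 3<γ isLn isRoot 7root≤p p≤1)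
    where
    5≤n : 5 ℕ.≤ n
    5≤n = ℕ.≤-trans (ℕ.m≤m+n 5 315) 320≤n
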